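{- There is a constant $C$ such that for every sufficiently large $n$ there exists a $C_4$-free $1$-planar graph on $n$ vertices with at least $2.4n-C$ edges.
   Context: All graphs are finite and simple. A graph is $k$-planar if it admits a drawing in the plane in which every edge is crossed at most $k$ times. A graph is $C_\ell$-free if it contains no cycle of length $\ell$ as a subgraph. (The paper states the edge count as $2.4n-O(1)$.) -}

module Defs where

open import Data.Bool.Base using (Bool; T)
open import Data.Fin.Base as Fin using (Fin; toℕ)
import Data.Fin.Properties as Fin
open import Data.Integer.Base using (+_)
open import Data.List.Base using (List; length; filter; cartesianProduct; allFin)
open import Data.Nat.Base as ℕ using (ℕ; suc; NonZero)
open import Data.Nat.DivMod using (_%_)
open import Data.Product using (∃; _×_; _,_)
open import Data.Rational.Base as ℚ using (ℚ; 0ℚ; 1ℚ)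
import Data.Rational.Properties as ℚ
open import Function.Definitions using (Injective)
open import Relation.Binary.PropositionalEquality using (_≡_; _≢_; sym; subst; cong)
open import Relation.Nullary using (¬_)
open import Relation.Nullary.Decidable using (_×-dec_; T?)
open import Relation.Unary using (Decidable)

-- Real numbers as Cauchy sequences of rationals; equality is _≈_.

Eventually : (ℕ → Set) → Set
Eventually P = ∃ λ N → ∀ n → N ℕ.≤ n → P n

record ℝ : Set where
  field
    seq    : ℕ → ℚ
    cauchy : ∀ ε → 0ℚ ℚ.< ε →
             ∃ λ N → ∀ m n → N ℕ.≤ m → N ℕ.≤ n →
             ℚ.∣ seq m ℚ.- seq n ∣ ℚ.< ε

open ℝ public

infix 4 _≈_ _≤_ _<_ _≈²_

_≈_ : ℝ → ℝ → Set
x ≈ y = ∀ ε → 0ℚ ℚ.< ε → Eventually λ n → ℚ.∣ seq x n ℚ.- seq y n ∣ ℚ.< ε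

_≤_ : ℝ → ℝ → Set
x ≤ y = ∀ ε → 0ℚ ℚ.< ε → Eventually λ n → seq x n ℚ.≤ seq y n ℚ.+ ε

_<_ : ℝ → ℝ → Set
x < y = ∃ λ ε → 0ℚ ℚ.< ε × Eventually λ n → seq x n ℚ.+ ε ℚ.≤ seq y n

-- Near ε x y means ∣ x - y ∣ < ε.  The gap η < ε makes the relation
-- invariant under _≈_.
Near : ℚ → ℝ → ℝ → Set
Near ε x y = ∃ λ η → η ℚ.< ε × Eventually λ n → ℚ.∣ seq x n ℚ.- seq y n ∣ ℚ.≤ η

fromℚ : ℚ → ℝ
fromℚ q = record
  { seq    = λ _ → q
  ; cauchy = λ ε 0<ε → 0 , λ _ _ _ _ →
      subst (ℚ._< ε) (sym (cong ℚ.∣_∣ (ℚ.+-inverseʳ q))) 0<ε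
  }

0ℝ 1ℝ : ℝ
0ℝ = fromℚ 0ℚ
1ℝ = fromℚ 1ℚ

ℝ² : Set
ℝ² = ℝ × ℝ

_≈²_ : ℝ² → ℝ² → Set
(x , y) ≈² (x′ , y′) = x ≈ x′ × y ≈ y′

-- Distance in the maximum norm, which induces the usual topology.
Near² : ℚ → ℝ² → ℝ² → Set
Near² ε (x , y) (x′ , y′) = Near ε x x′ × Near ε y y′

record UnitInterval : Set where
  constructor mkI
  field
    pt   : ℝ
    0≤pt : 0ℝ ≤ pt
    pt≤1 : pt ≤ 1ℝ

open UnitInterval public

-- Continuity implies that `path` respects _≈_, so `path` is a map on the
-- real unit interval and not merely on representatives.
record Arc (p q : ℝ²) : Set where
  field
    path       : UnitInterval → ℝ²
    continuous : ∀ s ε → 0ℚ ℚ.< ε →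
                 ∃ λ δ → 0ℚ ℚ.< δ ×
                 (∀ t → Near δ (pt s) (pt t) → Near² ε (path s) (path t))
    injective  : ∀ s t → path s ≈² path t → pt s ≈ pt t
    starts     : ∀ t → pt t ≈ 0ℝ → path t ≈² p
    ends       : ∀ t → pt t ≈ 1ℝ → path t ≈² q

open Arc public

InInterior : ∀ {p q} → ℝ² → Arc p q → Set
InInterior r γ = ∃ λ t → 0ℝ < pt t × pt t < 1ℝ × path γ t ≈² r

record Graph (n : ℕ) : Set where
  field
    adj    : Fin n → Fin n → Bool
    symm   : ∀ u v → T (adj u v) → T (adj v u)
    irrefl : ∀ u → ¬ T (adj u u)

open Graph public

-- Every undirected edge is represented once, smaller endpoint first.
record Edge {n : ℕ} (G : Graph n) : Set where
  constructor mkEdge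
  field
    lo hi  : Fin n
    .lo<hi : lo Fin.< hi
    .joins : T (adj G lo hi)

open Edge public

edgePairs : ∀ {n} → Graph n → List (Fin n × Fin n)
edgePairs {n} G = filter isEdge? (cartesianProduct (allFin n) (allFin n))
  where
  IsEdge : Fin n × Fin n → Set
  IsEdge (u , v) = u Fin.< v × T (adj G u v)

  isEdge? : Decidable IsEdge
  isEdge? (u , v) = (u Fin.<? v) ×-dec T? (adj G u v)

edgeCount : ∀ {n} → Graph n → ℕ
edgeCount G = length (edgePairs G)

-- A (not necessarily induced) copy of the cycle with vertices
-- vert 0 , … , vert (ℓ - 1) in cyclic order.
record Cycle {n : ℕ} (G : Graph n) (ℓ : ℕ) .{{_ : NonZero ℓ}} : Set where
  field
    3≤ℓ      : 3 ℕ.≤ ℓ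
    vert     : Fin ℓ → Fin n
    distinct : Injective _≡_ _≡_ vert
    closed   : ∀ i j → toℕ j ≡ suc (toℕ i) % ℓ → T (adj G (vert i) (vert j))

CycleFree : (ℓ : ℕ) .{{_ : NonZero ℓ}} → ∀ {n} → Graph n → Set
CycleFree ℓ G = ¬ Cycle G ℓ

record Drawing {n : ℕ} (G : Graph n) : Set where
  field
    place     : Fin n → ℝ²
    place-inj : Injective _≡_ _≈²_ place
    arc       : (e : Edge G) → Arc (place (lo e)) (place (hi e))
    avoids    : ∀ e w → ¬ InInterior (place w) (arc e)

open Drawing public

-- A crossing of e: another edge together with a point interior to both arcs.
-- Adjacent edges may cross, and every common interior point counts; a point
-- interior to several other edges counts once for each of them.
record Crossing {n : ℕ} {G : Graph n} (D : Drawing G) (e : Edge G) : Set where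
  field
    other    : Edge G
    other≢   : other ≢ e
    point    : ℝ²
    on-this  : InInterior point (arc D e)
    on-other : InInterior point (arc D other)

open Crossing public

SameCrossing : ∀ {n} {G : Graph n} {D : Drawing G} {e : Edge G} →
               Crossing D e → Crossing D e → Set
SameCrossing c d = other c ≡ other d × point c ≈² point d

CrossedAtMost : ∀ {n} {G : Graph n} → ℕ → Drawing G → Edge G → Set
CrossedAtMost k D e =
  ¬ (∃ λ (c : Fin (suc k) → Crossing D e) → Injective _≡_ SameCrossing c)

_-planar : ℕ → ∀ {n} → Graph n → Set
(k -planar) G = ∃ λ (D : Drawing G) → ∀ e → CrossedAtMost k D e

ℕ→ℚ : ℕ → ℚ
ℕ→ℚ n = + n ℚ./ 1

{-# OPTIONS --safe #-}
-- A periodic pattern on a cylinder with 10 vertices and 24 edges per period, of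
-- which 8 disjoint pairs cross and no others, is rolled out in the plane: the k-th period is
-- the image of the first one under multiplication by (-4)ᵏ, and edges are drawn
-- as straight segments.  By homogeneity, the mutual position of two edges
-- depends only on how many periods apart they are.  Distances below four are
-- settled by a finite computation with signed areas.  At larger distances the
-- line through the outer edge has the inner edge on one side, because every
-- pattern edge spans a triangle of nonzero area with the origin.  Likewise
-- a 4-cycle could only meet boundedly many periods, which leaves a finite check.
-- The graph on n vertices is induced by the first n vertices of the pattern.
module Submission where

open import Defs
open import Data.Bool.Base using (T)
open import Data.Fin.Base as Fin using (Fin; toℕ)
open import Data.Fin.Patterns
import Data.Fin.Properties as Fin
open import Data.Integer.Base as ℤ using (ℤ; +_; -[1+_]; 0ℤ)
import Data.Integer.Properties as ℤ
open import Data.Integer.Solver using () renaming (module +-*-Solver to ℤ-Solver)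
open import Data.List.Membership.Propositional using (_∈_)
open import Data.List.Membership.Propositional.Properties using (∈-filter⁺; ∈-cartesianProduct⁺; ∈-allFin)
import Data.List.Membership.Setoid.Properties as Membershipₛ
open import Data.List.Relation.Unary.Any using (index)
open import Data.Nat.Base as ℕ using (ℕ; suc) renaming (_≤_ to _≤ℕ_)
open import Data.Nat.DivMod using (m≡m%n+[m/n]*n; [m+kn]%n≡m%n; m<n⇒m%n≡m; +-distrib-/-∣ʳ; m<n⇒m/n≡0; m*n/n≡m; m%n<n; m/n*n≤m; m≥n⇒m/n>0)
import Data.Nat.DivMod as ℕ
open import Data.Nat.Divisibility using (divides-refl)
import Data.Nat.Properties as ℕ
open import Data.Nat.Solver using () renaming (module +-*-Solver to ℕ-Solver)
open import Data.Product using (∃; _×_; _,_; proj₁; proj₂; uncurry)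
open import Data.Product.Properties using (≡-dec)
open import Data.Rational.Base as ℚ using (ℚ; 0ℚ; 1ℚ; _/_; _+_; _*_; _-_) renaming (_≤_ to _≤ℚ_)
open import Data.Rational.Literals using (fromℤ)
import Data.Rational.Properties as ℚ
open import Data.Rational.Solver using () renaming (module +-*-Solver to ℚ-Solver)
import Data.Rational.Unnormalised.Base as ℚᵘ
import Data.Rational.Unnormalised.Properties as ℚᵘ
open import Data.Sum.Base as Sum using (_⊎_; inj₁; inj₂; [_,_]′)
open import Data.Vec.Base using (Vec; []; _∷_; lookup)
open import Function.Base using (_∘_; id)
open import Relation.Binary.Definitions using (tri<; tri≈; tri>)
open import Relation.Binary.PropositionalEquality
open import Relation.Nullary using (¬_; contradiction; yes; no; Dec)
open import Relation.Nullary.Decidable using (_×-dec_; _⊎-dec_; _→-dec_; ¬?; True; T?; map′; ⌊_⌋; toWitness; fromWitness; recompute; decidable-stable)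

-- Rational sequences and straight segments

module _ where

  open ℚ-Solver using (solve; con; _:=_; _:+_; _:*_; _:-_; :-_)

  ev-map : ∀ {P Q : ℕ → Set} → (∀ n → P n → Q n) → Eventually P → Eventually Q
  ev-map f (N , p) = N , λ n N≤n → f n (p n N≤n)

  ev-zip : ∀ {P Q R : ℕ → Set} → (∀ n → P n → Q n → R n) →
           Eventually P → Eventually Q → Eventually R
  ev-zip f (M , p) (N , q) = M ℕ.⊔ N , λ n M⊔N≤n →
    f n (p n (ℕ.m⊔n≤o⇒m≤o M N M⊔N≤n)) (q n (ℕ.m⊔n≤o⇒n≤o M N M⊔N≤n))

  -- `x ≈ y` unfolds to `Null` of the termwise difference, so closure properties of null sequences
  -- serve directly as laws of real equality.
  Null : (ℕ → ℚ) → Set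
  Null u = ∀ ε → 0ℚ ℚ.< ε → Eventually λ n → ℚ.∣ u n ∣ ℚ.< ε

  null-cong : ∀ {u v} → (∀ n → u n ≡ v n) → Null u → Null v
  null-cong u≡v nu ε 0<ε = ev-map (λ n → subst (λ q → ℚ.∣ q ∣ ℚ.< ε) (u≡v n)) (nu ε 0<ε)

  half : ℚ → ℚ
  half ε = ε * ℚ.½

  half-pos : ∀ {ε} → 0ℚ ℚ.< ε → 0ℚ ℚ.< half ε
  half-pos {ε} 0<ε = ℚ.positive⁻¹ _ {{ℚ.pos*pos⇒pos ε {{ℚ.positive 0<ε}} ℚ.½}}

  half+half : ∀ ε → half ε + half ε ≡ ε
  half+half = solve 1 (λ ε → ε :* con ℚ.½ :+ ε :* con ℚ.½ := ε) refl

  null-+ : ∀ {u v} → Null u → Null v → Null (λ n → u n + v n)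
  null-+ {u} {v} nu nv ε 0<ε = ev-zip step (nu (half ε) (half-pos 0<ε)) (nv (half ε) (half-pos 0<ε))
    where
    step : ∀ n → ℚ.∣ u n ∣ ℚ.< half ε → ℚ.∣ v n ∣ ℚ.< half ε → ℚ.∣ u n + v n ∣ ℚ.< ε
    step n p q = ℚ.≤-<-trans (ℚ.∣p+q∣≤∣p∣+∣q∣ (u n) (v n))
      (subst (ℚ.∣ u n ∣ + ℚ.∣ v n ∣ ℚ.<_) (half+half ε) (ℚ.+-mono-< p q))

  -- The summand 1 keeps the Lipschitz constant positive when d = 0.
  lip : ℚ → ℚ
  lip d = 1ℚ + ℚ.∣ d ∣

  lip-pos : ∀ d → ℚ.Positive (lip d)
  lip-pos d = ℚ.pos+nonNeg⇒pos 1ℚ ℚ.∣ d ∣ {{ℚ.∣-∣-nonNeg d}}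

  lip-bound : ∀ d x → ℚ.∣ d * x ∣ ℚ.≤ lip d * ℚ.∣ x ∣
  lip-bound d x = subst (ℚ._≤ lip d * ℚ.∣ x ∣) (sym (ℚ.∣p*q∣≡∣p∣*∣q∣ d x))
    (ℚ.*-monoʳ-≤-nonNeg ℚ.∣ x ∣ {{ℚ.∣-∣-nonNeg x}}
      (subst (ℚ._≤ lip d) (ℚ.+-identityˡ ℚ.∣ d ∣)
        (ℚ.+-monoˡ-≤ ℚ.∣ d ∣ (ℚ.nonNegative⁻¹ 1ℚ))))

  shrink : ℚ → ℚ → ℚ
  shrink d ε = (ℚ.1/ lip d) {{ℚ.pos⇒nonZero (lip d) {{lip-pos d}}}} * ε

  shrink-pos : ∀ d {ε} → 0ℚ ℚ.< ε → 0ℚ ℚ.< shrink d ε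
  shrink-pos d {ε} 0<ε = ℚ.positive⁻¹ _
    {{ℚ.pos*pos⇒pos ((ℚ.1/ lip d) {{ℚ.pos⇒nonZero (lip d) {{lip-pos d}}}}) {{ℚ.1/pos⇒pos (lip d) {{lip-pos d}}}} ε {{ℚ.positive 0<ε}}}}

  lip*shrink : ∀ d ε → lip d * shrink d ε ≡ ε
  lip*shrink d ε = begin
    lip d * (1/l * ε)  ≡⟨ ℚ.*-assoc (lip d) 1/l ε ⟨
    lip d * 1/l * ε    ≡⟨ cong (_* ε) (ℚ.*-inverseʳ (lip d) {{nz}}) ⟩
    1ℚ * ε             ≡⟨ ℚ.*-identityˡ ε ⟩
    ε                  ∎
    where
    open ≡-Reasoning
    nz  = ℚ.pos⇒nonZero (lip d) {{lip-pos d}}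
    1/l = (ℚ.1/ lip d) {{nz}}

  lip-< : ∀ d {ε x} → x ℚ.< shrink d ε → lip d * x ℚ.< ε
  lip-< d {ε} {x} x<s = subst (lip d * x ℚ.<_) (lip*shrink d ε)
    (ℚ.*-monoʳ-<-pos (lip d) {{lip-pos d}} x<s)

  null-* : ∀ c {u} → Null u → Null (λ n → c * u n)
  null-* c {u} nu ε 0<ε = ev-map (λ n ∣u∣<s → ℚ.≤-<-trans (lip-bound c (u n)) (lip-< c ∣u∣<s))
    (nu (shrink c ε) (shrink-pos c 0<ε))

  null-cancel : ∀ {c u} → c ≢ 0ℚ → Null (λ n → c * u n) → Null u
  null-cancel {c} {u} c≢0 ncu = null-cong eq (null-* 1/c ncu)
    where
    nz  = ℚ.≢-nonZero c≢0
    1/c = (ℚ.1/ c) {{nz}}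
    eq : ∀ n → 1/c * (c * u n) ≡ u n
    eq n = trans (sym (ℚ.*-assoc 1/c c (u n)))
      (trans (cong (_* u n) (ℚ.*-inverseˡ c {{nz}})) (ℚ.*-identityˡ (u n)))

  null-sym : ∀ {u v : ℕ → ℚ} → Null (λ n → u n - v n) → Null (λ n → v n - u n)
  null-sym {u} {v} = null-cong (λ n → solve 2 (λ x y → con (ℚ.- 1ℚ) :* (x :- y) := y :- x) refl (u n) (v n))
    ∘ null-* (ℚ.- 1ℚ)

  null-trans : ∀ {u v w : ℕ → ℚ} → Null (λ n → u n - v n) → Null (λ n → v n - w n) →
               Null (λ n → u n - w n)
  null-trans {u} {v} {w} nuv nvw = null-cong
    (λ n → solve 3 (λ x y z → (x :- y) :+ (y :- z) := x :- z) refl (u n) (v n) (w n))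
    (null-+ nuv nvw)

  null-bounded-away : ∀ {u η} → 0ℚ ℚ.< η → Null u → ¬ Eventually (λ n → η ℚ.≤ ℚ.∣ u n ∣)
  null-bounded-away {η = η} 0<η nu away
    with N , p ← ev-zip (λ n → ℚ.≤-<-trans) away (nu η 0<η) = ℚ.<-irrefl refl (p N ℕ.≤-refl)

  ∣∣-pos : ∀ {q} → q ≢ 0ℚ → 0ℚ ℚ.< ℚ.∣ q ∣
  ∣∣-pos {q} q≢0 with ℚ.<-cmp 0ℚ ℚ.∣ q ∣
  ... | tri< 0<q _ _ = 0<q
  ... | tri≈ _ 0≡q _ = contradiction (ℚ.∣p∣≡0⇒p≡0 q (sym 0≡q)) q≢0
  ... | tri> _ _ q<0 = contradiction (ℚ.≤-<-trans (ℚ.0≤∣p∣ q) q<0) (ℚ.<-irrefl refl)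

  null-const : ∀ {c} → Null (λ _ → c) → ¬ (c ≢ 0ℚ)
  null-const nc c≢0 = null-bounded-away (∣∣-pos c≢0) nc (0 , λ _ _ → ℚ.≤-refl)

  -- Straight segments as arcs.

  ℚ² : Set
  ℚ² = ℚ × ℚ

  -- Twice the signed area of the triangle; as a function of `r` it is affine and vanishes on the
  -- line `pq`.
  orient : ℚ² → ℚ² → ℚ² → ℚ
  orient (p₁ , p₂) (q₁ , q₂) (r₁ , r₂) = (q₁ - p₁) * (r₂ - p₂) - (q₂ - p₂) * (r₁ - p₁)

  fromℚ² : ℚ² → ℝ²
  fromℚ² (x , y) = fromℚ x , fromℚ y

  affine-diff : ∀ a b x y → (a + (b - a) * x) - (a + (b - a) * y) ≡ (b - a) * (x - y)
  affine-diff = solve 4 (λ a b x y → (a :+ (b :- a) :* x) :- (a :+ (b :- a) :* y) := (b :- a) :* (x :- y)) refl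

  affine : ℚ → ℚ → ℝ → ℝ
  affine a b t = record
    { seq    = λ n → a + (b - a) * seq t n
    ; cauchy = λ ε 0<ε →
        let N , close = cauchy t (shrink (b - a) ε) (shrink-pos (b - a) 0<ε)
        in N , λ m n N≤m N≤n → subst (λ q → ℚ.∣ q ∣ ℚ.< ε) (sym (affine-diff a b (seq t m) (seq t n)))
             (ℚ.≤-<-trans (lip-bound (b - a) _) (lip-< (b - a) (close m n N≤m N≤n)))
    }
  affine-cong : ∀ a b {s t} → s ≈ t → affine a b s ≈ affine a b t
  affine-cong a b {s} {t} s≈t =
    null-cong (λ n → sym (affine-diff a b (seq s n) (seq t n))) (null-* (b - a) s≈t)

  affine-near : ∀ a b ε {s t} → Near (shrink (b - a) ε) s t → Near ε (affine a b s) (affine a b t)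
  affine-near a b ε {s} {t} (η , η<δ , close) = lip (b - a) * η , lip-< (b - a) η<δ , ev-map step close
    where
    step : ∀ n → ℚ.∣ seq s n - seq t n ∣ ℚ.≤ η →
           ℚ.∣ seq (affine a b s) n - seq (affine a b t) n ∣ ℚ.≤ lip (b - a) * η
    step n ∣∣≤η = subst (λ q → ℚ.∣ q ∣ ℚ.≤ lip (b - a) * η) (sym (affine-diff a b (seq s n) (seq t n)))
      (ℚ.≤-trans (lip-bound (b - a) _)
        (ℚ.*-monoˡ-≤-nonNeg (lip (b - a)) {{ℚ.pos⇒nonNeg (lip (b - a)) {{lip-pos (b - a)}}}} ∣∣≤η))

  affine-injective : ∀ a b {s t} → b - a ≢ 0ℚ → affine a b s ≈ affine a b t → s ≈ t
  affine-injective a b {s} {t} b-a≢0 =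
    null-cancel b-a≢0 ∘ null-cong (λ n → affine-diff a b (seq s n) (seq t n))

  near-mono : ∀ {δ δ′ x y} → δ ℚ.≤ δ′ → Near δ x y → Near δ′ x y
  near-mono δ≤δ′ (η , η<δ , close) = η , ℚ.<-≤-trans η<δ δ≤δ′ , close

  -- Names a coordinate in which the points differ; injectivity of the segment is read off from that
  -- coordinate.
  Distinct : ℚ² → ℚ² → Set
  Distinct (p₁ , p₂) (q₁ , q₂) = q₁ - p₁ ≢ 0ℚ ⊎ q₂ - p₂ ≢ 0ℚ

  segment : ∀ p q → Distinct p q → Arc (fromℚ² p) (fromℚ² q)
  segment (p₁ , p₂) (q₁ , q₂) p≢q = record
    { path       = λ t → affine p₁ q₁ (pt t) , affine p₂ q₂ (pt t)
    ; continuous = λ s ε 0<ε →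
        let δ₁ = shrink (q₁ - p₁) ε ; δ₂ = shrink (q₂ - p₂) ε in
        δ₁ ℚ.⊓ δ₂ , ⊓-pos (shrink-pos (q₁ - p₁) 0<ε) (shrink-pos (q₂ - p₂) 0<ε) , λ t near →
          affine-near p₁ q₁ ε {pt s} {pt t} (near-mono {x = pt s} {y = pt t} (ℚ.p⊓q≤p δ₁ δ₂) near)
        , affine-near p₂ q₂ ε {pt s} {pt t} (near-mono {x = pt s} {y = pt t} (ℚ.p⊓q≤q δ₁ δ₂) near)
    ; injective  = λ s t (eq₁ , eq₂) →
        [ (λ d → affine-injective p₁ q₁ {pt s} {pt t} d eq₁)
        , (λ d → affine-injective p₂ q₂ {pt s} {pt t} d eq₂) ]′ p≢q
    ; starts     = λ t t≈0 → start p₁ q₁ (pt t) t≈0 , start p₂ q₂ (pt t) t≈0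
    ; ends       = λ t t≈1 → end p₁ q₁ (pt t) t≈1 , end p₂ q₂ (pt t) t≈1
    }
    where
    ⊓-pos : ∀ {x y} → 0ℚ ℚ.< x → 0ℚ ℚ.< y → 0ℚ ℚ.< x ℚ.⊓ y
    ⊓-pos {x} {y} 0<x 0<y = [ (λ eq → subst (0ℚ ℚ.<_) (sym eq) 0<x)
                            , (λ eq → subst (0ℚ ℚ.<_) (sym eq) 0<y) ]′ (ℚ.⊓-sel x y)
    start : ∀ a b t → t ≈ 0ℝ → affine a b t ≈ fromℚ a
    start a b t t≈0 = null-cong
      (λ n → solve 3 (λ a b x → (b :- a) :* (x :- con 0ℚ) := (a :+ (b :- a) :* x) :- a) refl a b (seq t n))
      (null-* (b - a) t≈0)
    end : ∀ a b t → t ≈ 1ℝ → affine a b t ≈ fromℚ b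
    end a b t t≈1 = null-cong
      (λ n → solve 3 (λ a b x → (b :- a) :* (x :- con 1ℚ) := (a :+ (b :- a) :* x) :- b) refl a b (seq t n))
      (null-* (b - a) t≈1)

  -- Order on the reals and ends of arcs.

  0<1 : 0ℚ ℚ.< 1ℚ
  0<1 = ℚ.positive⁻¹ 1ℚ

  ≤ᴿ-refl : ∀ x → x ≤ x
  ≤ᴿ-refl x ε 0<ε = 0 , λ n _ → subst (ℚ._≤ seq x n + ε) (ℚ.+-identityʳ (seq x n))
    (ℚ.+-monoʳ-≤ (seq x n) (ℚ.<⇒≤ 0<ε))

  0≤1 : 0ℝ ≤ 1ℝ
  0≤1 ε 0<ε = 0 , λ _ _ → ℚ.≤-trans (ℚ.<⇒≤ 0<ε) (subst (ℚ._≤ 1ℚ + ε) (ℚ.+-identityˡ ε) (ℚ.+-monoˡ-≤ ε (ℚ.<⇒≤ 0<1)))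

  p≤∣p∣ : ∀ p → p ℚ.≤ ℚ.∣ p ∣
  p≤∣p∣ p with ℚ.≤-total 0ℚ p
  ... | inj₁ 0≤p = ℚ.≤-reflexive (sym (ℚ.0≤p⇒∣p∣≡p 0≤p))
  ... | inj₂ p≤0 = ℚ.≤-trans p≤0 (ℚ.0≤∣p∣ p)

  ≈-refl : ∀ x → x ≈ x
  ≈-refl x ε 0<ε = 0 , λ n _ → subst (ℚ._< ε) (sym (cong ℚ.∣_∣ (ℚ.+-inverseʳ (seq x n)))) 0<ε

  ≈-sym : ∀ x y → x ≈ y → y ≈ x
  ≈-sym x y = null-sym {seq x} {seq y}

  ≈-trans : ∀ x y z → x ≈ y → y ≈ z → x ≈ z
  ≈-trans x y z = null-trans {seq x} {seq y} {seq z}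

  ≈²-sym : ∀ p q → p ≈² q → q ≈² p
  ≈²-sym (x , y) (x′ , y′) (a , b) = ≈-sym x x′ a , ≈-sym y y′ b

  ≈²-trans : ∀ p q r → p ≈² q → q ≈² r → p ≈² r
  ≈²-trans (x , y) (x′ , y′) (x″ , y″) (a , b) (c , d) = ≈-trans x x′ x″ a c , ≈-trans y y′ y″ b d

  <⇒≉ : ∀ x y → x < y → ¬ (x ≈ y)
  <⇒≉ x y (ε , 0<ε , gap) x≈y = null-bounded-away 0<ε (≈-sym x y x≈y) (ev-map step gap)
    where
    step : ∀ n → seq x n + ε ℚ.≤ seq y n → ε ℚ.≤ ℚ.∣ seq y n - seq x n ∣
    step n le = ℚ.≤-trans (subst (ℚ._≤ seq y n - seq x n)
        (solve 2 (λ x e → (x :+ e) :- x := e) refl (seq x n) ε)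
        (ℚ.+-monoˡ-≤ (ℚ.- seq x n) le)) (p≤∣p∣ _)

  -- By injectivity a parameter sent to the start equals 0, whereas interior parameters are strictly
  -- positive.
  start-∉ : ∀ {p q} (γ : Arc p q) → ¬ InInterior p γ
  start-∉ {p} γ (t , 0<t , _ , γt≈p) = <⇒≉ 0ℝ (pt t) 0<t (≈-sym (pt t) 0ℝ (injective γ t 0ᴵ
    (≈²-trans (path γ t) p (path γ 0ᴵ) γt≈p (≈²-sym (path γ 0ᴵ) p (starts γ 0ᴵ (≈-refl 0ℝ))))))
    where
    0ᴵ = mkI 0ℝ (≤ᴿ-refl 0ℝ) 0≤1

  end-∉ : ∀ {p q} (γ : Arc p q) → ¬ InInterior q γ
  end-∉ {q = q} γ (t , _ , t<1 , γt≈q) = <⇒≉ (pt t) 1ℝ t<1 (injective γ t 1ᴵ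
    (≈²-trans (path γ t) q (path γ 1ᴵ) γt≈q (≈²-sym (path γ 1ᴵ) q (ends γ 1ᴵ (≈-refl 1ℝ)))))
    where
    1ᴵ = mkI 1ℝ 0≤1 (≤ᴿ-refl 1ℝ)

  -- Separation by lines and uniqueness of meeting points.

  *-nonNeg : ∀ {x y} → 0ℚ ℚ.≤ x → 0ℚ ℚ.≤ y → 0ℚ ℚ.≤ x * y
  *-nonNeg {x} {y} 0≤x 0≤y = ℚ.nonNegative⁻¹ (x * y)
    {{ℚ.nonNeg*nonNeg⇒nonNeg x {{ℚ.nonNegative 0≤x}} y {{ℚ.nonNegative 0≤y}}}}

  *-pos : ∀ {x y} → 0ℚ ℚ.< x → 0ℚ ℚ.< y → 0ℚ ℚ.< x * y
  *-pos {x} {y} 0<x 0<y = ℚ.positive⁻¹ (x * y)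
    {{ℚ.pos*pos⇒pos x {{ℚ.positive 0<x}} y {{ℚ.positive 0<y}}}}

  ≤⇒0≤- : ∀ {x y} → x ℚ.≤ y → 0ℚ ℚ.≤ y - x
  ≤⇒0≤- {x} {y} x≤y = subst (ℚ._≤ y - x) (ℚ.+-inverseʳ x) (ℚ.+-monoˡ-≤ (ℚ.- x) x≤y)

  0≤-⇒≤ : ∀ {x y} → 0ℚ ℚ.≤ y - x → x ℚ.≤ y
  0≤-⇒≤ {x} {y} 0≤y-x = subst₂ ℚ._≤_ (ℚ.+-identityˡ x)
    (solve 2 (λ x y → (y :- x) :+ x := y) refl x y) (ℚ.+-monoˡ-≤ x 0≤y-x)

  same-sign : ∀ a b → 0ℚ ℚ.≤ a * b → (0ℚ ℚ.≤ a × 0ℚ ℚ.≤ b) ⊎ (0ℚ ℚ.≤ ℚ.- a × 0ℚ ℚ.≤ ℚ.- b)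
  same-sign a b 0≤ab with ℚ.<-cmp 0ℚ a
  ... | tri< 0<a _ _ = inj₁ (ℚ.<⇒≤ 0<a , ℚ.*-cancelˡ-≤-pos a {{ℚ.positive 0<a}}
          (subst (ℚ._≤ a * b) (sym (ℚ.*-zeroʳ a)) 0≤ab))
  ... | tri> _ _ a<0 = inj₂ (ℚ.neg-antimono-≤ (ℚ.<⇒≤ a<0) , ℚ.neg-antimono-≤
          (ℚ.*-cancelˡ-≤-neg a {{ℚ.negative a<0}} (subst (ℚ._≤ a * b) (sym (ℚ.*-zeroʳ a)) 0≤ab)))
  ... | tri≈ _ refl _ with ℚ.≤-total 0ℚ b
  ...   | inj₁ 0≤b = inj₁ (ℚ.≤-refl , 0≤b)
  ...   | inj₂ b≤0 = inj₂ (ℚ.≤-refl , ℚ.neg-antimono-≤ b≤0)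

  -- Once `ε ≤ x` and `x ≤ 1 - ε′` hold for the terms `x` of `t`, the value `(1 - x) a + x b` is at
  -- least `ε′ a + ε b`. This bound is positive because `a` and `b` are nonnegative and not both
  -- zero.
  interior-nonzero⁺ : ∀ {a b} (t : ℝ) → 0ℝ < t → t < 1ℝ → 0ℚ ℚ.≤ a → 0ℚ ℚ.≤ b → a + b ≢ 0ℚ →
                      ¬ Null (λ n → a + (b - a) * seq t n)
  interior-nonzero⁺ {a} {b} t (ε , 0<ε , ε≤t) (ε′ , 0<ε′ , t≤1-ε′) 0≤a 0≤b a+b≢0 null =
    null-bounded-away 0<η null (ev-zip step ε≤t t≤1-ε′)
    where
    η = ε′ * a + ε * b
    0<η : 0ℚ ℚ.< η
    0<η with ℚ.<-cmp 0ℚ a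
    ... | tri< 0<a _ _ = ℚ.+-mono-<-≤ (*-pos 0<ε′ 0<a) (*-nonNeg (ℚ.<⇒≤ 0<ε) 0≤b)
    ... | tri> _ _ a<0 = contradiction (ℚ.≤-<-trans 0≤a a<0) (ℚ.<-irrefl refl)
    ... | tri≈ _ refl _ with ℚ.<-cmp 0ℚ b
    ...   | tri< 0<b _ _ = ℚ.+-mono-≤-< (*-nonNeg (ℚ.<⇒≤ 0<ε′) 0≤a) (*-pos 0<ε 0<b)
    ...   | tri≈ _ refl _ = contradiction refl a+b≢0
    ...   | tri> _ _ b<0 = contradiction (ℚ.≤-<-trans 0≤b b<0) (ℚ.<-irrefl refl)
    step : ∀ n → 0ℚ + ε ℚ.≤ seq t n → seq t n + ε′ ℚ.≤ 1ℚ → η ℚ.≤ ℚ.∣ a + (b - a) * seq t n ∣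
    step n ε≤x x≤1-ε′ = ℚ.≤-trans (0≤-⇒≤ (subst (0ℚ ℚ.≤_)
        (solve 5 (λ a b x e e′ → (con 1ℚ :- (x :+ e′)) :* a :+ (x :- (con 0ℚ :+ e)) :* b
                   := (a :+ (b :- a) :* x) :- (e′ :* a :+ e :* b)) refl a b (seq t n) ε ε′)
        (ℚ.+-mono-≤ (*-nonNeg (≤⇒0≤- x≤1-ε′) 0≤a) (*-nonNeg (≤⇒0≤- ε≤x) 0≤b)))) (p≤∣p∣ _)

  interior-nonzero : ∀ {a b} (t : ℝ) → 0ℝ < t → t < 1ℝ → 0ℚ ℚ.≤ a * b → a + b ≢ 0ℚ →
                     ¬ Null (λ n → a + (b - a) * seq t n)
  interior-nonzero {a} {b} t 0<t t<1 0≤ab a+b≢0 null with same-sign a b 0≤ab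
  ... | inj₁ (0≤a , 0≤b) = interior-nonzero⁺ t 0<t t<1 0≤a 0≤b a+b≢0 null
  ... | inj₂ (0≤-a , 0≤-b) = interior-nonzero⁺ t 0<t t<1 0≤-a 0≤-b
    (λ eq → a+b≢0 (ℚ.neg-injective (trans (ℚ.neg-distrib-+ a b) eq)))
    (null-cong (λ n → solve 3 (λ a b x → con (ℚ.- 1ℚ) :* (a :+ (b :- a) :* x)
                         := (:- a) :+ ((:- b) :- (:- a)) :* x) refl a b (seq t n))
               (null-* (ℚ.- 1ℚ) null))

  -- A common point lies on the line `pq`, where `orient p q` vanishes, and along `rs` that function
  -- interpolates affinely between its values at `r` and `s`. Weighting the two coordinate
  -- differences by `q₂ - p₂` and `-(q₁ - p₁)` eliminates the parameter on `pq`.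
  orient-null : ∀ p q r s {d d′} t t′ →
    path (segment p q d) t ≈² path (segment r s d′) t′ →
    Null (λ n → orient p q r + (orient p q s - orient p q r) * seq (pt t′) n)
  orient-null (p₁ , p₂) (q₁ , q₂) (r₁ , r₂) (s₁ , s₂) t t′ (nx , ny) = null-cong
    (λ n → solve 10 (λ p₁ p₂ q₁ q₂ r₁ r₂ s₁ s₂ x y →
        (q₂ :- p₂) :* ((p₁ :+ (q₁ :- p₁) :* x) :- (r₁ :+ (s₁ :- r₁) :* y))
          :+ (:- (q₁ :- p₁)) :* ((p₂ :+ (q₂ :- p₂) :* x) :- (r₂ :+ (s₂ :- r₂) :* y))
        := (let or = (q₁ :- p₁) :* (r₂ :- p₂) :- (q₂ :- p₂) :* (r₁ :- p₁)
                os = (q₁ :- p₁) :* (s₂ :- p₂) :- (q₂ :- p₂) :* (s₁ :- p₁)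
            in or :+ (os :- or) :* y))
      refl p₁ p₂ q₁ q₂ r₁ r₂ s₁ s₂ (seq (pt t) n) (seq (pt t′) n))
    (null-+ (null-* (q₂ - p₂) nx) (null-* (ℚ.- (q₁ - p₁)) ny))

  -- The line pq has r and s weakly on one side, and does not contain both.
  OneSide : ℚ² → ℚ² → ℚ² → ℚ² → Set
  OneSide p q r s = 0ℚ ℚ.≤ orient p q r * orient p q s × orient p q r + orient p q s ≢ 0ℚ

  -- A common point would be a zero of `orient p q` at an interior parameter of `rs`. One end of
  -- `rs` may lie on the line `pq`, which admits edges with a shared endpoint.
  one-side⇒disjoint : ∀ p q r s {d d′ z} → OneSide p q r s →
    InInterior z (segment p q d) → ¬ InInterior z (segment r s d′)
  one-side⇒disjoint p q r s {d} {d′} {z} (0≤ab , a+b≢0) (t , _ , _ , γt≈z) (t′ , 0<t′ , t′<1 , γ′t′≈z) =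
    interior-nonzero {orient p q r} {orient p q s} (pt t′) 0<t′ t′<1 0≤ab a+b≢0 (orient-null p q r s {d} {d′} t t′
      (≈²-trans (path (segment p q d) t) z (path (segment r s d′) t′) γt≈z
        (≈²-sym (path (segment r s d′) t′) z γ′t′≈z)))

  off-line⇒∉ : ∀ p q w {d} → orient p q w ≢ 0ℚ → ¬ InInterior (fromℚ² w) (segment p q d)
  off-line⇒∉ (p₁ , p₂) (q₁ , q₂) (w₁ , w₂) a≢0 (t , _ , _ , nx , ny) = null-const
    (null-cong (λ n → solve 7 (λ p₁ p₂ q₁ q₂ w₁ w₂ x →
        (q₂ :- p₂) :* ((p₁ :+ (q₁ :- p₁) :* x) :- w₁)
          :+ (:- (q₁ :- p₁)) :* ((p₂ :+ (q₂ :- p₂) :* x) :- w₂)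
        := (q₁ :- p₁) :* (w₂ :- p₂) :- (q₂ :- p₂) :* (w₁ :- p₁))
      refl p₁ p₂ q₁ q₂ w₁ w₂ (seq (pt t) n))
    (null-+ (null-* (q₂ - p₂) nx) (null-* (ℚ.- (q₁ - p₁)) ny)))
    a≢0

  -- Along `pq` the function `orient r s` is affine with nonzero slope and vanishes at both meeting
  -- points, so their parameters on `pq` agree.
  meet-unique : ∀ p q r s {d d′ z z′} → orient r s p ≢ orient r s q →
    InInterior z (segment p q d) → InInterior z (segment r s d′) →
    InInterior z′ (segment p q d) → InInterior z′ (segment r s d′) → z ≈² z′
  meet-unique p@(p₁ , p₂) q@(q₁ , q₂) r s {d} {d′} {z} {z′} a≢b
    (t , _ , _ , γt≈z) (u , _ , _ , δu≈z) (t′ , _ , _ , γt′≈z′) (u′ , _ , _ , δu′≈z′) =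
    ≈²-trans z (path γ t) z′ (≈²-sym (path γ t) z γt≈z)
      (≈²-trans (path γ t) (path γ t′) z′
        (affine-cong p₁ q₁ {pt t} {pt t′} t≈t′ , affine-cong p₂ q₂ {pt t} {pt t′} t≈t′) γt′≈z′)
    where
    γ = segment p q d
    δ = segment r s d′
    a = orient r s p
    b = orient r s q
    b-a≢0 : b - a ≢ 0ℚ
    b-a≢0 eq = a≢b (sym (ℚ.≤-antisym
      (0≤-⇒≤ (subst (0ℚ ℚ.≤_) (trans (cong ℚ.-_ (sym eq)) (solve 2 (λ a b → :- (b :- a) := a :- b) refl a b)) ℚ.≤-refl))
      (0≤-⇒≤ (ℚ.≤-reflexive (sym eq)))))
    null : ∀ v w z → path δ v ≈² z → path γ w ≈² z → Null (λ n → a + (b - a) * seq (pt w) n)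
    null v w z δv≈z γw≈z = orient-null r s p q {d′} {d} v w
      (≈²-trans (path δ v) z (path γ w) δv≈z (≈²-sym (path γ w) z γw≈z))
    t≈t′ : pt t ≈ pt t′
    t≈t′ = null-cancel b-a≢0 (null-cong
      (λ n → solve 4 (λ a c x y → (a :+ c :* x) :+ con (ℚ.- 1ℚ) :* (a :+ c :* y) := c :* (x :- y))
               refl a (b - a) (seq (pt t) n) (seq (pt t′) n))
      (null-+ (null u t z δu≈z γt≈z) (null-* (ℚ.- 1ℚ) (null u′ t′ z′ δu′≈z′ γt′≈z′))))

-- Integer geometry of the pattern

module _ where

  open ℤ-Solver using (solve; _:=_; _:+_; _:*_; _:-_; :-_)

  ℤ² : Set
  ℤ² = ℤ × ℤ

  infixr 7 _•_

  _•_ : ℤ → ℤ² → ℤ²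
  c • (x , y) = c ℤ.* x , c ℤ.* y

  ∥_∥ : ℤ² → ℕ
  ∥ x , y ∥ = ℤ.∣ x ∣ ℕ.+ ℤ.∣ y ∣

  _⊝_ : ℤ² → ℤ² → ℤ²
  (x , y) ⊝ (x′ , y′) = x ℤ.- x′ , y ℤ.- y′

  det : ℤ² → ℤ² → ℤ
  det (x , y) (x′ , y′) = x ℤ.* y′ ℤ.- y ℤ.* x′

  area : ℤ² → ℤ² → ℤ² → ℤ
  area p q r = det (q ⊝ p) (r ⊝ p)

  -- The integer counterpart of `OneSide`, which makes separation decidable.
  Clear : ℤ² → ℤ² → ℤ² → ℤ² → Set
  Clear p q r s = 0ℤ ℤ.≤ area p q r ℤ.* area p q s × area p q r ℤ.+ area p q s ≢ 0ℤ

  clear? : ∀ p q r s → Dec (Clear p q r s)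
  clear? p q r s = (0ℤ ℤ.≤? area p q r ℤ.* area p q s) ×-dec ¬? (area p q r ℤ.+ area p q s ℤ.≟ 0ℤ)

  -- Either segment may supply the separating line.
  Apart : ℤ² × ℤ² → ℤ² × ℤ² → Set
  Apart (p , q) (r , s) = Clear p q r s ⊎ Clear r s p q

  apart? : ∀ e f → Dec (Apart e f)
  apart? (p , q) (r , s) = clear? p q r s ⊎-dec clear? r s p q

  -- The pattern and its oriented edges.

  abstract
    -- The positions in period 0. They are opaque outside the finite checks, and the later arguments
    -- rely on the checked facts alone.
    base : Fin 10 → ℤ²
    base = lookup
      ( (+ 2     , -[1+ 6 ])  ∷ (-[1+ 6 ] , -[1+ 15 ]) ∷ (-[1+ 12 ] , + 3) ∷ (+ 11 , -[1+ 9 ])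
      ∷ (-[1+ 3 ] , -[1+ 0 ]) ∷ (+ 0 , + 13) ∷ (+ 6 , + 9) ∷ (-[1+ 0 ] , + 8)
      ∷ (+ 8 , + 1) ∷ (-[1+ 5 ] , -[1+ 2 ]) ∷ [] )

  -- The negative sign adds a half turn to the dilation from one period to the next.
  μ : ℤ
  μ = -[1+ 3 ]

  Vertex : Set
  Vertex = ℕ × Fin 10

  pos : Vertex → ℤ²
  pos (r , i) = (μ ℤ.^ r) • base i

  -- A row of `table` and an entry of that row. Pairing the edges this way reduces 1-planarity to
  -- showing that edges of different rows or different cells are disjoint.
  Kind : Set
  Kind = Fin 12 × Fin 2

  abstract
    -- Vertices are (period, class), with periods relative to a cell.  The two
    -- edges in each of the first eight rows cross; no other edges do.
    table : Vec (Vec (Vertex × Vertex) 2) 12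
    table =
        (((0 , 0F) , (1 , 7F)) ∷ ((0 , 1F) , (0 , 3F)) ∷ [])
      ∷ (((0 , 1F) , (0 , 2F)) ∷ ((0 , 9F) , (1 , 8F)) ∷ [])
      ∷ (((0 , 1F) , (1 , 5F)) ∷ ((1 , 6F) , (1 , 7F)) ∷ [])
      ∷ (((0 , 2F) , (1 , 3F)) ∷ ((1 , 0F) , (1 , 8F)) ∷ [])
      ∷ (((0 , 3F) , (1 , 5F)) ∷ ((1 , 2F) , (1 , 7F)) ∷ [])
      ∷ (((0 , 3F) , (0 , 6F)) ∷ ((0 , 8F) , (1 , 4F)) ∷ [])
      ∷ (((0 , 3F) , (1 , 9F)) ∷ ((1 , 2F) , (1 , 4F)) ∷ [])
      ∷ (((0 , 5F) , (1 , 9F)) ∷ ((1 , 0F) , (1 , 4F)) ∷ [])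
      ∷ (((0 , 0F) , (0 , 9F)) ∷ ((0 , 1F) , (1 , 8F)) ∷ [])
      ∷ (((0 , 1F) , (0 , 9F)) ∷ ((0 , 2F) , (0 , 5F)) ∷ [])
      ∷ (((0 , 5F) , (1 , 0F)) ∷ ((0 , 5F) , (0 , 7F)) ∷ [])
      ∷ (((0 , 6F) , (1 , 4F)) ∷ ((0 , 6F) , (0 , 8F)) ∷ [])
      ∷ []

  endpoints : Kind → Vertex × Vertex
  endpoints (c , b) = lookup (lookup table c) b

  seg : Kind → ℤ² × ℤ²
  seg t = pos (proj₁ (endpoints t)) , pos (proj₂ (endpoints t))

  scale : ℤ → ℤ² × ℤ² → ℤ² × ℤ²
  scale c (p , q) = c • p , c • q

  decide : ∀ {A : Set} (a? : Dec A) {_ : True a?} → A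
  decide a? {yes!} = toWitness {a? = a?} yes!

  _≟ⱽ_ : (v w : Vertex) → Dec (v ≡ w)
  _≟ⱽ_ = ≡-dec ℕ._≟_ Fin._≟_

  -- The place of a vertex when the periods are listed from the inside outwards; the inverse of
  -- `vertex`.
  number : Vertex → ℕ
  number (r , i) = toℕ i ℕ.+ r ℕ.* 10

  -- An edge kind together with a direction of traversal.
  Half : Set
  Half = Fin 12 × Fin 2 × Fin 2

  tail head : Half → Vertex
  tail (c , b , 0F) = proj₁ (endpoints (c , b))
  tail (c , b , 1F) = proj₂ (endpoints (c , b))
  head (c , b , 0F) = proj₂ (endpoints (c , b))
  head (c , b , 1F) = proj₁ (endpoints (c , b))

  ring : Vertex → ℕ
  ring = proj₁

  class : Vertex → Fin 10
  class = proj₂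

  all-half? : ∀ {P : Half → Set} → (∀ h → Dec (P h)) → Dec (∀ h → P h)
  all-half? P? = map′ (λ p (c , b , s) → p c b s) (λ p c b s → p (c , b , s))
    (Fin.all? λ c → Fin.all? λ b → Fin.all? λ s → P? (c , b , s))

  -- If the walks h₁h₂ and h₃h₄ with a common start also end in the same place, then
  -- their midpoints agree or the walks return to the start.  Differences of periods
  -- are moved to the side where they become sums.
  NoSquare : Half → Half → Half → Half → Set
  NoSquare h₁ h₂ h₃ h₄ =
    class (head h₂) ≡ class (head h₄) →
    ring (head h₁) ℕ.+ ring (head h₂) ℕ.+ (ring (tail h₃) ℕ.+ ring (tail h₄)) ≡
    ring (head h₃) ℕ.+ ring (head h₄) ℕ.+ (ring (tail h₁) ℕ.+ ring (tail h₂)) →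
    (class (head h₁) ≡ class (head h₃) × ring (head h₁) ℕ.+ ring (tail h₃) ≡ ring (head h₃) ℕ.+ ring (tail h₁))
    ⊎ (class (tail h₁) ≡ class (head h₂) × ring (head h₁) ℕ.+ ring (head h₂) ≡ ring (tail h₁) ℕ.+ ring (tail h₂))

  noSquare? : ∀ h₁ h₂ h₃ h₄ → Dec (NoSquare h₁ h₂ h₃ h₄)
  noSquare? h₁ h₂ h₃ h₄ = (_ Fin.≟ _) →-dec ((_ ℕ.≟ _) →-dec
    (((_ Fin.≟ _) ×-dec (_ ℕ.≟ _)) ⊎-dec ((_ Fin.≟ _) ×-dec (_ ℕ.≟ _))))

  -- Finite checks on the pattern.

  abstract
    -- By homogeneity the inner edge may be taken in cell 0, which leaves finitely many cases. The
    -- exempt case is an edge against itself or against its partner in the row.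
    near-apart : ∀ c c′ (d : Fin 4) →
      (c ≡ c′ × d ≡ 0F) ⊎ (∀ b b′ → Apart (seg (c , b)) (scale (μ ℤ.^ toℕ d) (seg (c′ , b′))))
    near-apart = decide (Fin.all? λ c → Fin.all? λ c′ → Fin.all? λ (d : Fin 4) →
      ((c Fin.≟ c′) ×-dec (d Fin.≟ 0F)) ⊎-dec
      (Fin.all? λ b → Fin.all? λ b′ → apart? (seg (c , b)) (scale (μ ℤ.^ toℕ d) (seg (c′ , b′)))))

    -- Gives a crossing pair a single crossing point, as seen from either of its edges.
    partners-not-parallel : ∀ c → let (p , q) = seg (c , 0F) ; (r , s) = seg (c , 1F) in
      area r s p ≢ area r s q × area p q r ≢ area p q s
    partners-not-parallel = decide (Fin.all? λ c → ¬? (_ ℤ.≟ _) ×-dec ¬? (_ ℤ.≟ _))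

    -- 256 = ∣ μ ∣ ^ 4 is the scale at which the near checks stop.
    far-edge : ∀ c b (o : Fin 2) i → let (p , q) = seg (c , b) in
      ℤ.∣ det (q ⊝ p) (pos (toℕ o , i)) ∣ ℕ.< ℤ.∣ det p q ∣ ℕ.* 256
    far-edge = decide (Fin.all? λ c → Fin.all? λ b → Fin.all? λ o → Fin.all? λ i → _ ℕ.<? _)

    -- The signed area of `p`, `q` and a vertex scaled by a large `m` is
    -- `det p q + m * det (q ⊝ p) (base i)`. Its second summand either vanishes, leaving a nonzero
    -- constant, or dominates.
    far-vertex : ∀ c b i → let (p , q) = seg (c , b) in
      det (q ⊝ p) (base i) ≡ 0ℤ ⊎ ℤ.∣ det p q ∣ ℕ.< ℤ.∣ det (q ⊝ p) (base i) ∣ ℕ.* 256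
    far-vertex = decide (Fin.all? λ c → Fin.all? λ b → Fin.all? λ i → (_ ℤ.≟ _) ⊎-dec (_ ℕ.<? _))

    near-outer-vertex : ∀ c b (d : Fin 4) i → let (p , q) = seg (c , b) in
      (toℕ d , i) ≡ proj₁ (endpoints (c , b)) ⊎ (toℕ d , i) ≡ proj₂ (endpoints (c , b)) ⊎
      area p q (pos (toℕ d , i)) ≢ 0ℤ
    near-outer-vertex = decide (Fin.all? λ c → Fin.all? λ b → Fin.all? λ d → Fin.all? λ i →
      (_ ≟ⱽ _) ⊎-dec ((_ ≟ⱽ _) ⊎-dec ¬? (_ ℤ.≟ _)))

    -- Endpoints need no exception here: both ends of an edge from a later cell lie in later periods
    -- than the vertex.
    near-inner-vertex : ∀ c b (d : Fin 3) i → let (p , q) = scale (μ ℤ.^ suc (toℕ d)) (seg (c , b)) in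
      area p q (base i) ≢ 0ℤ
    near-inner-vertex = decide (Fin.all? λ c → Fin.all? λ b → Fin.all? λ d → Fin.all? λ i → ¬? (_ ℤ.≟ _))

    offset : ∀ c b → let (v , w) = endpoints (c , b) in proj₁ v ℕ.< 2 × proj₁ w ℕ.< 2
    offset = decide (Fin.all? λ c → Fin.all? λ b → (_ ℕ.<? _) ×-dec (_ ℕ.<? _))

    near-distinct : ∀ i j (d : Fin 4) → base i ≡ pos (toℕ d , j) → (0 , i) ≡ (toℕ d , j)
    near-distinct = decide (Fin.all? λ i → Fin.all? λ j → Fin.all? λ d →
      (≡-dec ℤ._≟_ ℤ._≟_ _ _) →-dec (_ ≟ⱽ _))

    far-distinct : ∀ i j → ∥ base i ∥ ℕ.< ∥ base j ∥ ℕ.* 256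
    far-distinct = decide (Fin.all? λ i → Fin.all? λ j → _ ℕ.<? _)

    -- Orients the entries of `table` as `Edge` requires, smaller end first.
    number-< : ∀ c b → let (v , w) = endpoints (c , b) in number v ℕ.< number w
    number-< = decide (Fin.all? λ c → Fin.all? λ b → _ ℕ.<? _)

    -- Keeps the edges distinct in the count: the classes of the ends reveal the kind, after which
    -- the period of one end reveals the cell.
    classes-unique : ∀ c b c′ b′ →
      let (v , w) = endpoints (c , b) ; (v′ , w′) = endpoints (c′ , b′) in
      class v ≡ class v′ → class w ≡ class w′ → c ≡ c′ × b ≡ b′
    classes-unique = decide (Fin.all? λ c → Fin.all? λ b → Fin.all? λ c′ → Fin.all? λ b′ →
      (_ Fin.≟ _) →-dec ((_ Fin.≟ _) →-dec ((_ Fin.≟ _) ×-dec (_ Fin.≟ _))))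

    -- Each class condition follows directly upon the half-edge that it restricts, which prunes the
    -- search through the 48^4 quadruples.
    no-square : ∀ h₁ h₂ → class (head h₁) ≡ class (tail h₂) →
      ∀ h₃ → class (tail h₁) ≡ class (tail h₃) →
      ∀ h₄ → class (head h₃) ≡ class (tail h₄) → NoSquare h₁ h₂ h₃ h₄
    no-square = decide (all-half? λ h₁ → all-half? λ h₂ → (_ Fin.≟ _) →-dec
      (all-half? λ h₃ → (_ Fin.≟ _) →-dec
      (all-half? λ h₄ → (_ Fin.≟ _) →-dec noSquare? h₁ h₂ h₃ h₄)))

  -- Homogeneity, and domination at large distance.

  area-• : ∀ c p q r → area (c • p) (c • q) (c • r) ≡ c ℤ.* c ℤ.* area p q r
  area-• c (p₁ , p₂) (q₁ , q₂) (r₁ , r₂) = solve 7 (λ c p₁ p₂ q₁ q₂ r₁ r₂ →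
    (c :* q₁ :- c :* p₁) :* (c :* r₂ :- c :* p₂) :- (c :* q₂ :- c :* p₂) :* (c :* r₁ :- c :* p₁)
    := c :* c :* ((q₁ :- p₁) :* (r₂ :- p₂) :- (q₂ :- p₂) :* (r₁ :- p₁))) refl c p₁ p₂ q₁ q₂ r₁ r₂

  -- Isolates the term `c * det p q`, which outweighs the other summand in the bracket when the edge
  -- is far out.
  area-outer-edge : ∀ c p q r → area (c • p) (c • q) r ≡ c ℤ.* (det (q ⊝ p) r ℤ.+ c ℤ.* det p q)
  area-outer-edge c (p₁ , p₂) (q₁ , q₂) (r₁ , r₂) = solve 7 (λ c p₁ p₂ q₁ q₂ r₁ r₂ →
    (c :* q₁ :- c :* p₁) :* (r₂ :- c :* p₂) :- (c :* q₂ :- c :* p₂) :* (r₁ :- c :* p₁)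
    := c :* (((q₁ :- p₁) :* r₂ :- (q₂ :- p₂) :* r₁) :+ c :* (p₁ :* q₂ :- p₂ :* q₁))) refl c p₁ p₂ q₁ q₂ r₁ r₂

  area-outer-vertex : ∀ c p q r → area p q (c • r) ≡ det p q ℤ.+ c ℤ.* det (q ⊝ p) r
  area-outer-vertex c (p₁ , p₂) (q₁ , q₂) (r₁ , r₂) = solve 7 (λ c p₁ p₂ q₁ q₂ r₁ r₂ →
    (q₁ :- p₁) :* (c :* r₂ :- p₂) :- (q₂ :- p₂) :* (c :* r₁ :- p₁)
    := (p₁ :* q₂ :- p₂ :* q₁) :+ c :* ((q₁ :- p₁) :* r₂ :- (q₂ :- p₂) :* r₁)) refl c p₁ p₂ q₁ q₂ r₁ r₂

  •-assoc : ∀ a b p → a • (b • p) ≡ (a ℤ.* b) • p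
  •-assoc a b (x , y) = cong₂ _,_ (sym (ℤ.*-assoc a b x)) (sym (ℤ.*-assoc a b y))

  *-≢0 : ∀ {a b} → a ≢ 0ℤ → b ≢ 0ℤ → a ℤ.* b ≢ 0ℤ
  *-≢0 {a} a≢0 b≢0 ab≡0 = [ a≢0 , b≢0 ]′ (ℤ.i*j≡0⇒i≡0∨j≡0 a ab≡0)

  0≤square : ∀ a → 0ℤ ℤ.≤ a ℤ.* a
  0≤square (+ n)    = subst (0ℤ ℤ.≤_) (ℤ.pos-* n n) (ℤ.+≤+ ℕ.z≤n)
  0≤square -[1+ n ] = ℤ.+≤+ ℕ.z≤n

  0≤* : ∀ {a b} → 0ℤ ℤ.≤ a → 0ℤ ℤ.≤ b → 0ℤ ℤ.≤ a ℤ.* b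
  0≤* {+ m} {+ n} _ _ = subst (0ℤ ℤ.≤_) (ℤ.pos-* m n) (ℤ.+≤+ ℕ.z≤n)

  clear-scale : ∀ c p q r s → c ≢ 0ℤ → Clear p q r s → Clear (c • p) (c • q) (c • r) (c • s)
  clear-scale c p q r s c≢0 (0≤ab , a+b≢0) =
      subst (0ℤ ℤ.≤_) (sym (trans (cong₂ ℤ._*_ (area-• c p q r) (area-• c p q s))
        (solve 3 (λ k a b → (k :* a) :* (k :* b) := (k :* k) :* (a :* b)) refl (c ℤ.* c) (area p q r) (area p q s))))
        (0≤* (0≤square (c ℤ.* c)) 0≤ab)
    , subst (_≢ 0ℤ) (trans (ℤ.*-distribˡ-+ (c ℤ.* c) (area p q r) (area p q s)) (sym (cong₂ ℤ._+_ (area-• c p q r) (area-• c p q s))))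
        (*-≢0 (*-≢0 c≢0 c≢0) a+b≢0)

  apart-scale : ∀ c e f → c ≢ 0ℤ → Apart e f → Apart (scale c e) (scale c f)
  apart-scale c (p , q) (r , s) c≢0 =
    Sum.map (clear-scale c p q r s c≢0) (clear-scale c r s p q c≢0)

  dominated-pos : ∀ {a x} → 0ℤ ℤ.< x → ℤ.∣ a ∣ ℕ.< ℤ.∣ x ∣ → 0ℤ ℤ.< a ℤ.+ x
  dominated-pos {+ m} {+ n} 0<x lt = ℤ.+-mono-≤-< (ℤ.+≤+ (ℕ.z≤n {m})) 0<x
  dominated-pos { -[1+ m ]} {+ n} 0<x lt = subst (0ℤ ℤ.<_) (sym (ℤ.⊖-≥ (ℕ.<⇒≤ lt))) (ℤ.+<+ (ℕ.m<n⇒0<n∸m lt))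

  dominated-≢0 : ∀ {a x} → ℤ.∣ a ∣ ℕ.< ℤ.∣ x ∣ → a ℤ.+ x ≢ 0ℤ
  dominated-≢0 {a} {x} lt a+x≡0 = ℕ.<-irrefl (trans (cong ℤ.∣_∣ a≡-x) (ℤ.∣-i∣≡∣i∣ x)) lt
    where
    a≡-x : a ≡ ℤ.- x
    a≡-x = trans (solve 2 (λ a x → a := (a :+ x) :+ (:- x)) refl a x)
      (trans (cong (ℤ._+ ℤ.- x) a+x≡0) (ℤ.+-identityˡ (ℤ.- x)))

  dominated-clear⁺ : ∀ a b x → 0ℤ ℤ.< x → ℤ.∣ a ∣ ℕ.< ℤ.∣ x ∣ → ℤ.∣ b ∣ ℕ.< ℤ.∣ x ∣ →
    0ℤ ℤ.≤ (a ℤ.+ x) ℤ.* (b ℤ.+ x) × (a ℤ.+ x) ℤ.+ (b ℤ.+ x) ≢ 0ℤ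
  dominated-clear⁺ a b x 0<x a<x b<x =
    0≤* (ℤ.<⇒≤ 0<a+x) (ℤ.<⇒≤ 0<b+x) , λ eq → ℤ.<-irrefl (sym eq) (ℤ.+-mono-< 0<a+x 0<b+x)
    where
    0<a+x = dominated-pos {a} {x} 0<x a<x
    0<b+x = dominated-pos {b} {x} 0<x b<x

  -- Both sums inherit the sign of `x`. A negative `x` is reduced to a positive one by negating all
  -- three numbers.
  dominated-clear : ∀ a b x → ℤ.∣ a ∣ ℕ.< ℤ.∣ x ∣ → ℤ.∣ b ∣ ℕ.< ℤ.∣ x ∣ →
    0ℤ ℤ.≤ (a ℤ.+ x) ℤ.* (b ℤ.+ x) × (a ℤ.+ x) ℤ.+ (b ℤ.+ x) ≢ 0ℤ
  dominated-clear a b x a<x b<x with ℤ.<-cmp 0ℤ x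
  ... | tri< 0<x _ _ = dominated-clear⁺ a b x 0<x a<x b<x
  ... | tri≈ _ refl _ = contradiction a<x λ ()
  ... | tri> _ _ x<0 =
    let 0≤′ , ≢0′ = dominated-clear⁺ (ℤ.- a) (ℤ.- b) (ℤ.- x) (ℤ.neg-mono-< x<0)
          (subst₂ ℕ._<_ (sym (ℤ.∣-i∣≡∣i∣ a)) (sym (ℤ.∣-i∣≡∣i∣ x)) a<x)
          (subst₂ ℕ._<_ (sym (ℤ.∣-i∣≡∣i∣ b)) (sym (ℤ.∣-i∣≡∣i∣ x)) b<x)
    in subst (0ℤ ℤ.≤_) (solve 3 (λ a b x → ((:- a) :+ (:- x)) :* ((:- b) :+ (:- x)) := (a :+ x) :* (b :+ x)) refl a b x) 0≤′
     , λ eq → ≢0′ (trans (solve 3 (λ a b x → ((:- a) :+ (:- x)) :+ ((:- b) :+ (:- x)) := :- ((a :+ x) :+ (b :+ x))) refl a b x)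
                         (cong ℤ.-_ eq))

  ∣μ^∣ : ∀ n → ℤ.∣ μ ℤ.^ n ∣ ≡ 4 ℕ.^ n
  ∣μ^∣ 0       = refl
  ∣μ^∣ (suc n) = trans (ℤ.abs-* μ (μ ℤ.^ n)) (cong (4 ℕ.*_) (∣μ^∣ n))

  μ^≢0 : ∀ n → μ ℤ.^ n ≢ 0ℤ
  μ^≢0 n eq = ℕ.<-irrefl (trans (cong ℤ.∣_∣ (sym eq)) (∣μ^∣ n)) (ℕ.m^n>0 4 n)

  far-bound : ∀ d {a b} → a ℕ.< ℤ.∣ b ∣ ℕ.* 256 → a ℕ.< ℤ.∣ μ ℤ.^ (4 ℕ.+ d) ℤ.* b ∣
  far-bound d {a} {b} lt = ℕ.<-≤-trans lt (begin
    ℤ.∣ b ∣ ℕ.* 4 ℕ.^ 4                ≤⟨ ℕ.*-monoʳ-≤ ℤ.∣ b ∣ (ℕ.^-monoʳ-≤ 4 (ℕ.m≤m+n 4 d)) ⟩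
    ℤ.∣ b ∣ ℕ.* 4 ℕ.^ (4 ℕ.+ d)        ≡⟨ ℕ.*-comm ℤ.∣ b ∣ _ ⟩
    4 ℕ.^ (4 ℕ.+ d) ℕ.* ℤ.∣ b ∣        ≡⟨ cong (ℕ._* ℤ.∣ b ∣) (∣μ^∣ (4 ℕ.+ d)) ⟨
    ℤ.∣ μ ℤ.^ (4 ℕ.+ d) ∣ ℕ.* ℤ.∣ b ∣  ≡⟨ ℤ.abs-* (μ ℤ.^ (4 ℕ.+ d)) b ⟨
    ℤ.∣ μ ℤ.^ (4 ℕ.+ d) ℤ.* b ∣        ∎)
    where open ℕ.≤-Reasoning

  -- Both areas are `m` times a sum dominated by `m * det p q`. The factor `m`, whose sign
  -- alternates with `d`, enters their product as a square.
  far-clear : ∀ d p q z w →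
    ℤ.∣ det (q ⊝ p) z ∣ ℕ.< ℤ.∣ det p q ∣ ℕ.* 256 → ℤ.∣ det (q ⊝ p) w ∣ ℕ.< ℤ.∣ det p q ∣ ℕ.* 256 →
    Clear (μ ℤ.^ (4 ℕ.+ d) • p) (μ ℤ.^ (4 ℕ.+ d) • q) z w
  far-clear d p q z w z< w< =
      subst (0ℤ ℤ.≤_) (sym (trans (cong₂ ℤ._*_ (area-outer-edge m p q z) (area-outer-edge m p q w))
        (solve 3 (λ k a b → (k :* a) :* (k :* b) := (k :* k) :* (a :* b)) refl m (a ℤ.+ x) (b ℤ.+ x))))
        (0≤* (0≤square m) (proj₁ clear))
    , subst (_≢ 0ℤ) (trans (ℤ.*-distribˡ-+ m (a ℤ.+ x) (b ℤ.+ x))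
        (sym (cong₂ ℤ._+_ (area-outer-edge m p q z) (area-outer-edge m p q w))))
        (*-≢0 (μ^≢0 (4 ℕ.+ d)) (proj₂ clear))
    where
    m = μ ℤ.^ (4 ℕ.+ d)
    a = det (q ⊝ p) z
    b = det (q ⊝ p) w
    x = m ℤ.* det p q
    clear = dominated-clear a b x (far-bound d {b = det p q} z<) (far-bound d {b = det p q} w<)

  far-outer-vertex : ∀ d p q w → det p q ≢ 0ℤ →
    det (q ⊝ p) w ≡ 0ℤ ⊎ ℤ.∣ det p q ∣ ℕ.< ℤ.∣ det (q ⊝ p) w ∣ ℕ.* 256 →
    area p q (μ ℤ.^ (4 ℕ.+ d) • w) ≢ 0ℤ
  far-outer-vertex d p q w pq≢0 cond = subst (_≢ 0ℤ) (sym (area-outer-vertex m p q w))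
    ([ (λ eq → subst (_≢ 0ℤ) (sym (trans (cong (λ z → det p q ℤ.+ m ℤ.* z) eq)
                 (trans (cong (ℤ._+_ (det p q)) (ℤ.*-zeroʳ m)) (ℤ.+-identityʳ (det p q))))) pq≢0)
     , (λ lt → dominated-≢0 {det p q} {m ℤ.* det (q ⊝ p) w} (far-bound d {b = det (q ⊝ p) w} lt)) ]′ cond)
    where
    m = μ ℤ.^ (4 ℕ.+ d)

  far-inner-vertex : ∀ d p q w → ℤ.∣ det (q ⊝ p) w ∣ ℕ.< ℤ.∣ det p q ∣ ℕ.* 256 →
    area (μ ℤ.^ (4 ℕ.+ d) • p) (μ ℤ.^ (4 ℕ.+ d) • q) w ≢ 0ℤ
  far-inner-vertex d p q w lt = subst (_≢ 0ℤ) (sym (area-outer-edge m p q w))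
    (*-≢0 (μ^≢0 (4 ℕ.+ d)) (dominated-≢0 {det (q ⊝ p) w} {m ℤ.* det p q} (far-bound d {b = det p q} lt)))
    where
    m = μ ℤ.^ (4 ℕ.+ d)

  far-edge-pos : ∀ c b v → proj₁ v ℕ.< 2 → let (p , q) = seg (c , b) in
    ℤ.∣ det (q ⊝ p) (pos v) ∣ ℕ.< ℤ.∣ det p q ∣ ℕ.* 256
  far-edge-pos c b (o , i) o<2 = subst (λ o → let (p , q) = seg (c , b) in
      ℤ.∣ det (q ⊝ p) (pos (o , i)) ∣ ℕ.< ℤ.∣ det p q ∣ ℕ.* 256) (Fin.toℕ-fromℕ< o<2)
    (far-edge c b (Fin.fromℕ< o<2) i)

  cells-apart : ∀ {c c′} b b′ d → (c ≡ c′ × d ≡ 0) ⊎ Apart (seg (c , b)) (scale (μ ℤ.^ d) (seg (c′ , b′)))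
  cells-apart {c} {c′} b b′ 0 = Sum.map (λ (c≡c′ , _) → c≡c′ , refl) (λ apart → apart b b′) (near-apart c c′ 0F)
  cells-apart {c} {c′} b b′ 1 = Sum.map (λ { (_ , ()) }) (λ apart → apart b b′) (near-apart c c′ 1F)
  cells-apart {c} {c′} b b′ 2 = Sum.map (λ { (_ , ()) }) (λ apart → apart b b′) (near-apart c c′ 2F)
  cells-apart {c} {c′} b b′ 3 = Sum.map (λ { (_ , ()) }) (λ apart → apart b b′) (near-apart c c′ 3F)
  cells-apart {c} {c′} b b′ (suc (suc (suc (suc d)))) =
    -- The outer edge supplies the line, hence the second alternative of `Apart`. By `offset` the
    -- ends of the inner edge lie in periods 0 and 1, the range covered by `far-edge`.
    inj₂ (inj₂ (far-clear d (proj₁ (seg (c′ , b′))) (proj₂ (seg (c′ , b′))) (proj₁ (seg (c , b))) (proj₂ (seg (c , b)))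
      (far-edge-pos c′ b′ (proj₁ (endpoints (c , b))) (proj₁ (offset c b)))
      (far-edge-pos c′ b′ (proj₂ (endpoints (c , b))) (proj₂ (offset c b)))))

  -- A vanishing determinant would turn the strict bound in `far-edge` into a natural number below
  -- zero; any vertex serves.
  det≢0 : ∀ c b → let (p , q) = seg (c , b) in det p q ≢ 0ℤ
  det≢0 c b eq = ℕ.m<n⇒n≢0 (far-edge c b 0F 0F) (cong (λ z → ℤ.∣ z ∣ ℕ.* 256) eq)

  outer-vertex : ∀ c b d i → let (p , q) = seg (c , b) in
    (d , i) ≡ proj₁ (endpoints (c , b)) ⊎ (d , i) ≡ proj₂ (endpoints (c , b)) ⊎ area p q (pos (d , i)) ≢ 0ℤ
  outer-vertex c b 0 i = near-outer-vertex c b 0F i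
  outer-vertex c b 1 i = near-outer-vertex c b 1F i
  outer-vertex c b 2 i = near-outer-vertex c b 2F i
  outer-vertex c b 3 i = near-outer-vertex c b 3F i
  outer-vertex c b (suc (suc (suc (suc d)))) i =
    inj₂ (inj₂ (far-outer-vertex d (proj₁ (seg (c , b))) (proj₂ (seg (c , b))) (base i) (det≢0 c b) (far-vertex c b i)))

  inner-vertex : ∀ c b d i → let (p , q) = scale (μ ℤ.^ suc d) (seg (c , b)) in area p q (base i) ≢ 0ℤ
  inner-vertex c b 0 i = near-inner-vertex c b 0F i
  inner-vertex c b 1 i = near-inner-vertex c b 1F i
  inner-vertex c b 2 i = near-inner-vertex c b 2F i
  -- The exponent is already `suc d`, so three successors mean distance at least four. `far-edge`
  -- speaks of `pos (0 , i)`, from which the unit scalar is removed.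
  inner-vertex c b (suc (suc (suc d))) i =
    far-inner-vertex d (proj₁ (seg (c , b))) (proj₂ (seg (c , b))) (base i) (subst (λ z → let (p , q) = seg (c , b) in
      ℤ.∣ det (q ⊝ p) z ∣ ℕ.< ℤ.∣ det p q ∣ ℕ.* 256) (1• (base i)) (far-edge c b 0F i))
    where
    1• : ∀ z → ℤ.1ℤ • z ≡ z
    1• (x , y) = cong₂ _,_ (ℤ.*-identityˡ x) (ℤ.*-identityˡ y)

  ∥•∥ : ∀ c p → ∥ c • p ∥ ≡ ℤ.∣ c ∣ ℕ.* ∥ p ∥
  ∥•∥ c (x , y) = trans (cong₂ ℕ._+_ (ℤ.abs-* c x) (ℤ.abs-* c y))
    (sym (ℕ.*-distribˡ-+ ℤ.∣ c ∣ ℤ.∣ x ∣ ℤ.∣ y ∣))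

  •-cancel : ∀ c p q → c ≢ 0ℤ → c • p ≡ c • q → p ≡ q
  •-cancel c (x , y) (x′ , y′) c≢0 eq = cong₂ _,_
    (ℤ.*-cancelˡ-≡ c x x′ {{ℤ.≢-nonZero c≢0}} (cong proj₁ eq))
    (ℤ.*-cancelˡ-≡ c y y′ {{ℤ.≢-nonZero c≢0}} (cong proj₂ eq))

  distinct : ∀ i j d → base i ≡ pos (d , j) → (0 , i) ≡ (d , j)
  distinct i j 0 = near-distinct i j 0F
  distinct i j 1 = near-distinct i j 1F
  distinct i j 2 = near-distinct i j 2F
  distinct i j 3 = near-distinct i j 3F
  -- From distance four on, growth of the norm alone separates the vertices.
  distinct i j (suc (suc (suc (suc d)))) eq = contradiction (far-distinct i j) (ℕ.≤⇒≯ (begin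
    ∥ base j ∥ ℕ.* 4 ℕ.^ 4               ≤⟨ ℕ.*-monoʳ-≤ ∥ base j ∥ (ℕ.^-monoʳ-≤ 4 (ℕ.m≤m+n 4 d)) ⟩
    ∥ base j ∥ ℕ.* 4 ℕ.^ (4 ℕ.+ d)       ≡⟨ ℕ.*-comm ∥ base j ∥ _ ⟩
    4 ℕ.^ (4 ℕ.+ d) ℕ.* ∥ base j ∥       ≡⟨ cong (ℕ._* ∥ base j ∥) (∣μ^∣ (4 ℕ.+ d)) ⟨
    ℤ.∣ μ ℤ.^ (4 ℕ.+ d) ∣ ℕ.* ∥ base j ∥ ≡⟨ ∥•∥ (μ ℤ.^ (4 ℕ.+ d)) (base j) ⟨
    ∥ pos (4 ℕ.+ d , j) ∥                ≡⟨ cong ∥_∥ eq ⟨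
    ∥ base i ∥                           ∎))
    where open ℕ.≤-Reasoning

  -- Transfer to arbitrary periods.

  shift : ℕ → Vertex → Vertex
  shift r (o , i) = r ℕ.+ o , i

  pos-shift : ∀ r v → pos (shift r v) ≡ (μ ℤ.^ r) • pos v
  pos-shift r (o , i) = trans (cong (_• base i) (ℤ.^-distribˡ-+-* μ r o))
    (sym (•-assoc (μ ℤ.^ r) (μ ℤ.^ o) (base i)))

  distinct-shift : ∀ r d i j → pos (r , i) ≡ pos (r ℕ.+ d , j) → (r , i) ≡ (r ℕ.+ d , j)
  distinct-shift r d i j eq = trans (cong (_, i) (sym (ℕ.+-identityʳ r)))
    (cong (shift r) (distinct i j d (•-cancel (μ ℤ.^ r) (base i) (pos (d , j)) (μ^≢0 r)
      (trans eq (pos-shift r (d , j))))))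

  pos-injective : ∀ v w → pos v ≡ pos w → v ≡ w
  pos-injective (r , i) (s , j) eq with ℕ.≤-total r s
  ... | inj₁ r≤s with d , refl ← ℕ.m≤n⇒∃[o]m+o≡n r≤s = distinct-shift r d i j eq
  ... | inj₂ s≤r with d , refl ← ℕ.m≤n⇒∃[o]m+o≡n s≤r = sym (distinct-shift s d j i (sym eq))

  segAt : ℕ → Kind → ℤ² × ℤ²
  segAt r t = pos (shift r (proj₁ (endpoints t))) , pos (shift r (proj₂ (endpoints t)))

  segAt-scale : ∀ r t → segAt r t ≡ scale (μ ℤ.^ r) (seg t)
  segAt-scale r t = cong₂ _,_ (pos-shift r (proj₁ (endpoints t))) (pos-shift r (proj₂ (endpoints t)))

  scale-scale : ∀ r d e → scale (μ ℤ.^ r) (scale (μ ℤ.^ d) e) ≡ scale (μ ℤ.^ (r ℕ.+ d)) e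
  scale-scale r d (p , q) = cong₂ _,_ (step p) (step q)
    where
    step : ∀ p → (μ ℤ.^ r) • ((μ ℤ.^ d) • p) ≡ (μ ℤ.^ (r ℕ.+ d)) • p
    step p = trans (•-assoc (μ ℤ.^ r) (μ ℤ.^ d) p) (cong (_• p) (sym (ℤ.^-distribˡ-+-* μ r d)))

  apart-shift : ∀ r d c b c′ b′ → (c ≡ c′ × d ≡ 0) ⊎ Apart (segAt r (c , b)) (segAt (r ℕ.+ d) (c′ , b′))
  apart-shift r d c b c′ b′ = Sum.map₂ (λ apart → subst₂ Apart
      (sym (segAt-scale r (c , b)))
      (trans (scale-scale r d (seg (c′ , b′))) (sym (segAt-scale (r ℕ.+ d) (c′ , b′))))
      (apart-scale (μ ℤ.^ r) (seg (c , b)) (scale (μ ℤ.^ d) (seg (c′ , b′))) (μ^≢0 r) apart))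
    (cells-apart b b′ d)

  -- The inner of the two cells is scaled back to cell 0; symmetry of `Apart` covers both orders of
  -- `r` and `s`.
  segments-apart : ∀ r s c b c′ b′ → (r ≡ s × c ≡ c′) ⊎ Apart (segAt r (c , b)) (segAt s (c′ , b′))
  segments-apart r s c b c′ b′ = [ up , down ]′ (ℕ.≤-total r s)
    where
    up : r ℕ.≤ s → (r ≡ s × c ≡ c′) ⊎ Apart (segAt r (c , b)) (segAt s (c′ , b′))
    up r≤s with d , refl ← ℕ.m≤n⇒∃[o]m+o≡n r≤s =
      Sum.map₁ (λ (c≡c′ , d≡0) → sym (trans (cong (r ℕ.+_) d≡0) (ℕ.+-identityʳ r)) , c≡c′)
        (apart-shift r d c b c′ b′)
    down : s ℕ.≤ r → (r ≡ s × c ≡ c′) ⊎ Apart (segAt r (c , b)) (segAt s (c′ , b′))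
    down s≤r with d , refl ← ℕ.m≤n⇒∃[o]m+o≡n s≤r =
      Sum.map (λ (c′≡c , d≡0) → trans (cong (s ℕ.+_) d≡0) (ℕ.+-identityʳ s) , sym c′≡c)
        Sum.swap (apart-shift s d c′ b′ c b)

  Transversal : ℤ² × ℤ² → ℤ² × ℤ² → Set
  Transversal (p , q) (r , s) = area r s p ≢ area r s q

  transversal-scale : ∀ m e f → m ≢ 0ℤ → Transversal e f → Transversal (scale m e) (scale m f)
  transversal-scale m (p , q) (r , s) m≢0 ≢ eq = ≢ (ℤ.*-cancelˡ-≡ (m ℤ.* m) (area r s p) (area r s q)
    {{ℤ.≢-nonZero (*-≢0 m≢0 m≢0)}} (trans (sym (area-• m r s p)) (trans eq (area-• m r s q))))

  partners-transversal : ∀ r c b b′ → b ≢ b′ → Transversal (segAt r (c , b)) (segAt r (c , b′))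
  partners-transversal r c b b′ b≢b′ = subst₂ Transversal (sym (segAt-scale r (c , b))) (sym (segAt-scale r (c , b′)))
    (transversal-scale (μ ℤ.^ r) (seg (c , b)) (seg (c , b′)) (μ^≢0 r) (unscaled b b′ b≢b′))
    where
    unscaled : ∀ b b′ → b ≢ b′ → Transversal (seg (c , b)) (seg (c , b′))
    unscaled 0F 0F ≢ = contradiction refl ≢
    unscaled 0F 1F _ = proj₁ (partners-not-parallel c)
    unscaled 1F 0F _ = proj₂ (partners-not-parallel c)
    unscaled 1F 1F ≢ = contradiction refl ≢

  OffLine : ℤ² × ℤ² → ℤ² → Set
  OffLine (p , q) w = area p q w ≢ 0ℤ

  offLine-scale : ∀ m e w → m ≢ 0ℤ → OffLine e w → OffLine (scale m e) (m • w)
  offLine-scale m (p , q) w m≢0 ≢ = subst (_≢ 0ℤ) (sym (area-• m p q w)) (*-≢0 (*-≢0 m≢0 m≢0) ≢)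

  vertex-off : ∀ r s c b i → (s , i) ≡ shift r (proj₁ (endpoints (c , b))) ⊎
    (s , i) ≡ shift r (proj₂ (endpoints (c , b))) ⊎ OffLine (segAt r (c , b)) (pos (s , i))
  vertex-off r s c b i = [ outer , inner ]′ (ℕ.≤-<-connex r s)
    where
    Goal = λ r s → (s , i) ≡ shift r (proj₁ (endpoints (c , b))) ⊎
      (s , i) ≡ shift r (proj₂ (endpoints (c , b))) ⊎ OffLine (segAt r (c , b)) (pos (s , i))
    outer : r ℕ.≤ s → Goal r s
    outer r≤s with d , refl ← ℕ.m≤n⇒∃[o]m+o≡n r≤s =
      Sum.map (cong (shift r)) (Sum.map (cong (shift r)) λ off →
        subst₂ OffLine (sym (segAt-scale r (c , b))) (sym (pos-shift r (d , i)))
          (offLine-scale (μ ℤ.^ r) (seg (c , b)) (pos (d , i)) (μ^≢0 r) off))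
        (outer-vertex c b d i)
    inner : s ℕ.< r → Goal r s
    inner s<r with d , refl ← ℕ.m≤n⇒∃[o]m+o≡n s<r = inj₂ (inj₂ (subst (λ e → OffLine e (pos (s , i)))
      (trans (scale-scale s (suc d) (seg (c , b)))
        (trans (cong (λ k → scale (μ ℤ.^ k) (seg (c , b))) (ℕ.+-suc s d)) (sym (segAt-scale (suc (s ℕ.+ d)) (c , b)))))
      (offLine-scale (μ ℤ.^ s) (scale (μ ℤ.^ suc d) (seg (c , b))) (base i) (μ^≢0 s) (inner-vertex c b d i))))

-- From integer to rational coordinates

fromℤ-+ : ∀ a b → fromℤ (a ℤ.+ b) ≡ fromℤ a ℚ.+ fromℤ b
fromℤ-+ a b = ℚ.toℚᵘ-injective (ℚᵘ.≃-trans
  (ℚᵘ.*≡* (cong (ℤ._* + 1) (sym (cong₂ ℤ._+_ (ℤ.*-identityʳ a) (ℤ.*-identityʳ b)))))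
  (ℚᵘ.≃-sym (ℚ.toℚᵘ-homo-+ (fromℤ a) (fromℤ b))))

fromℤ-* : ∀ a b → fromℤ (a ℤ.* b) ≡ fromℤ a ℚ.* fromℤ b
fromℤ-* a b = ℚ.toℚᵘ-injective (ℚᵘ.≃-sym (ℚ.toℚᵘ-homo-* (fromℤ a) (fromℤ b)))

fromℤ-neg : ∀ a → fromℤ (ℤ.- a) ≡ ℚ.- fromℤ a
fromℤ-neg (+ 0)       = refl
fromℤ-neg (+ (suc _)) = refl
fromℤ-neg -[1+ _ ]    = refl

fromℤ-- : ∀ a b → fromℤ (a ℤ.- b) ≡ fromℤ a ℚ.- fromℤ b
fromℤ-- a b = trans (fromℤ-+ a (ℤ.- b)) (cong (fromℤ a ℚ.+_) (fromℤ-neg b))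

fromℤ-mono-≤ : ∀ {a b} → a ℤ.≤ b → fromℤ a ℚ.≤ fromℤ b
fromℤ-mono-≤ a≤b = ℚ.*≤* (ℤ.*-monoʳ-≤-nonNeg (+ 1) a≤b)

fromℤ-injective : ∀ {a b} → fromℤ a ≡ fromℤ b → a ≡ b
fromℤ-injective = cong ℚ.numerator

-≡0⇒≡ : ∀ p q → p ℚ.- q ≡ 0ℚ → p ≡ q
-≡0⇒≡ p q eq = trans (solve 2 (λ p q → p := (p :- q) :+ q) refl p q) (trans (cong (ℚ._+ q) eq) (ℚ.+-identityˡ q))
  where open ℚ-Solver

fromℤ² : ℤ² → ℚ²
fromℤ² (x , y) = fromℤ x , fromℤ y

orient-fromℤ² : ∀ p q r → orient (fromℤ² p) (fromℤ² q) (fromℤ² r) ≡ fromℤ (area p q r)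
orient-fromℤ² (p₁ , p₂) (q₁ , q₂) (r₁ , r₂) = sym (trans
  (fromℤ-- ((q₁ ℤ.- p₁) ℤ.* (r₂ ℤ.- p₂)) ((q₂ ℤ.- p₂) ℤ.* (r₁ ℤ.- p₁)))
  (cong₂ ℚ._-_ (prod q₁ p₁ r₂ p₂) (prod q₂ p₂ r₁ p₁)))
  where
  prod : ∀ a b c d → fromℤ ((a ℤ.- b) ℤ.* (c ℤ.- d)) ≡ (fromℤ a ℚ.- fromℤ b) ℚ.* (fromℤ c ℚ.- fromℤ d)
  prod a b c d = trans (fromℤ-* (a ℤ.- b) (c ℤ.- d)) (cong₂ ℚ._*_ (fromℤ-- a b) (fromℤ-- c d))

clear⇒one-side : ∀ p q r s → Clear p q r s → OneSide (fromℤ² p) (fromℤ² q) (fromℤ² r) (fromℤ² s)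
clear⇒one-side p q r s (0≤ab , a+b≢0) =
    subst (0ℚ ℚ.≤_) (trans (fromℤ-* (area p q r) (area p q s))
      (sym (cong₂ ℚ._*_ (orient-fromℤ² p q r) (orient-fromℤ² p q s)))) (fromℤ-mono-≤ 0≤ab)
  , λ eq → a+b≢0 (fromℤ-injective (trans (fromℤ-+ (area p q r) (area p q s))
      (trans (sym (cong₂ ℚ._+_ (orient-fromℤ² p q r) (orient-fromℤ² p q s))) eq)))

-- The graph

vertex : ℕ → Vertex
vertex m = m ℕ./ 10 , m ℕ.mod 10

number-vertex : ∀ m → number (vertex m) ≡ m
number-vertex m = trans (cong (ℕ._+ m ℕ./ 10 ℕ.* 10) (Fin.toℕ-fromℕ< (m%n<n m 10))) (sym (m≡m%n+[m/n]*n m 10))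

vertex-number : ∀ v → vertex (number v) ≡ v
vertex-number (r , i) = cong₂ _,_
  (trans (+-distrib-/-∣ʳ (toℕ i) (divides-refl r))
    (cong₂ ℕ._+_ (m<n⇒m/n≡0 (Fin.toℕ<n i)) (m*n/n≡m r 10)))
  (Fin.toℕ-injective (trans (Fin.toℕ-fromℕ< (m%n<n (number (r , i)) 10))
    (trans ([m+kn]%n≡m%n (toℕ i) r 10) (m<n⇒m%n≡m (Fin.toℕ<n i)))))

number-shift : ∀ r v → number (shift r v) ≡ number v ℕ.+ r ℕ.* 10
number-shift r (o , i) = solve 3 (λ r o i → i :+ (r :+ o) :* con 10 := (i :+ o :* con 10) :+ r :* con 10) refl r o (toℕ i)
  where open ℕ-Solver

module _ {n : ℕ} where

  at : Fin n → Vertex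
  at u = vertex (toℕ u)

  at-injective : ∀ {u v} → at u ≡ at v → u ≡ v
  at-injective {u} {v} eq = Fin.toℕ-injective
    (trans (sym (number-vertex (toℕ u))) (trans (cong number eq) (number-vertex (toℕ v))))

  Joins : ℕ → Kind → Fin n → Fin n → Set
  Joins r t u v = at u ≡ shift r (proj₁ (endpoints t)) × at v ≡ shift r (proj₂ (endpoints t))

  -- Bounding r by n makes the relation decidable; r never exceeds the number of u.
  Link : Fin n → Fin n → Set
  Link u v = ∃ λ (r : Fin n) → ∃ λ c → ∃ λ b → Joins (toℕ r) (c , b) u v

  link? : ∀ u v → Dec (Link u v)
  link? u v = Fin.any? λ r → Fin.any? λ c → Fin.any? λ b → (_ ≟ⱽ _) ×-dec (_ ≟ⱽ _)

  joins-< : ∀ {r c b u v} → Joins r (c , b) u v → toℕ u ℕ.< toℕ v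
  joins-< {r} {c} {b} {u} {v} (eq , eq′) = subst₂ ℕ._<_ (num eq) (num eq′) (ℕ.+-monoˡ-< (r ℕ.* 10) (number-< c b))
    where
    num : ∀ {w x} → at w ≡ shift r x → number x ℕ.+ r ℕ.* 10 ≡ toℕ w
    num {w} {x} eq = trans (sym (number-shift r x)) (trans (cong number (sym eq)) (number-vertex (toℕ w)))

  link-< : ∀ {u v} → Link u v → toℕ u ℕ.< toℕ v
  link-< (_ , _ , _ , j) = joins-< j

adjacent? : ∀ {n} (u v : Fin n) → Dec (Link u v ⊎ Link v u)
adjacent? u v = link? u v ⊎-dec link? v u

spiral : ∀ n → Graph n
spiral n = record
  { adj    = λ u v → ⌊ adjacent? u v ⌋
  ; symm   = λ u v uv → fromWitness {a? = adjacent? v u} (Sum.swap (toWitness {a? = adjacent? u v} uv))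
  ; irrefl = λ u uu → [ loopless u , loopless u ]′ (toWitness {a? = adjacent? u u} uu)
  }
  where
  loopless : ∀ (u : Fin n) → ¬ Link u u
  loopless u l = ℕ.<-irrefl refl (link-< {u = u} {v = u} l)

module _ {n : ℕ} where

  edge-link : (e : Edge (spiral n)) → Link (lo e) (hi e)
  -- Decidability recovers the irrelevant fields, and a link from `v` to `u` would contradict the
  -- order of the ends.
  edge-link (mkEdge u v u<v uv) = [ id , (λ l → contradiction (link-< l) (ℕ.<⇒≯ (recompute (toℕ u ℕ.<? toℕ v) u<v))) ]′
    (toWitness {a? = adjacent? u v} (recompute (T? _) uv))

  -- Order and adjacency are irrelevant fields, so the endpoints determine the edge.
  edge-≡ : ∀ {e f : Edge (spiral n)} → lo e ≡ lo f → hi e ≡ hi f → e ≡ f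
  edge-≡ refl refl = refl

  -- Four-cycles

  Step : Fin n → Fin n → Set
  Step u v = ∃ λ r → ∃ λ h → at u ≡ shift r (tail h) × at v ≡ shift r (head h)

  step : ∀ u v → T (adj (spiral n) u v) → Step u v
  step u v uv = [ (λ (r , c , b , j) → toℕ r , (c , b , 0F) , j)
                , (λ (r , c , b , j) → toℕ r , (c , b , 1F) , proj₂ j , proj₁ j) ]′
    (toWitness {a? = adjacent? u v} uv)

  -- The periods of the four shared vertices give four equations, in whose sum the cells `r₁` to
  -- `r₄` cancel. What remains involves only the half-edges and is the premise checked in
  -- `no-square`.
  common-neighbour : ∀ {x y y′ z} → Step x y → Step y z → Step x y′ → Step y′ z → y ≡ y′ ⊎ x ≡ z
  common-neighbour {x} {y} {y′} {z} (r₁ , h₁ , x₁ , y₁) (r₂ , h₂ , y₂ , z₂) (r₃ , h₃ , x₃ , y₃) (r₄ , h₄ , y₄ , z₄) =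
    Sum.map
      (λ (cl , rg) → at-injective (trans y₁ (trans (cong₂ _,_ (ring-y rg) cl) (sym y₃))))
      (λ (cl , rg) → at-injective (trans x₁ (trans (cong₂ _,_ (ring-x rg) cl) (sym z₂))))
      (no-square h₁ h₂ (cong proj₂ e₁₂) h₃ (cong proj₂ e₁₃) h₄ (cong proj₂ e₃₄) (cong proj₂ e₂₄) total)
    where
    e₁₂ = trans (sym y₁) y₂
    e₁₃ = trans (sym x₁) x₃
    e₃₄ = trans (sym y₃) y₄
    e₂₄ = trans (sym z₂) z₄
    open ℕ-Solver
    open ≡-Reasoning
    R : Vertex → ℕ
    R = ring
    total : R (head h₁) ℕ.+ R (head h₂) ℕ.+ (R (tail h₃) ℕ.+ R (tail h₄)) ≡
            R (head h₃) ℕ.+ R (head h₄) ℕ.+ (R (tail h₁) ℕ.+ R (tail h₂))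
    total = ℕ.+-cancelˡ-≡ (r₁ ℕ.+ r₂ ℕ.+ (r₃ ℕ.+ r₄)) _ _ (begin
      (r₁ ℕ.+ r₂ ℕ.+ (r₃ ℕ.+ r₄)) ℕ.+ (R (head h₁) ℕ.+ R (head h₂) ℕ.+ (R (tail h₃) ℕ.+ R (tail h₄)))
        ≡⟨ regroup r₁ r₂ r₃ r₄ (R (head h₁)) (R (head h₂)) (R (tail h₃)) (R (tail h₄)) ⟩
      (r₁ ℕ.+ R (head h₁)) ℕ.+ (r₂ ℕ.+ R (head h₂)) ℕ.+ ((r₃ ℕ.+ R (tail h₃)) ℕ.+ (r₄ ℕ.+ R (tail h₄)))
        ≡⟨ cong₂ ℕ._+_ (cong₂ ℕ._+_ (cong proj₁ e₁₂) (cong proj₁ e₂₄))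
                       (cong₂ ℕ._+_ (sym (cong proj₁ e₁₃)) (sym (cong proj₁ e₃₄))) ⟩
      (r₂ ℕ.+ R (tail h₂)) ℕ.+ (r₄ ℕ.+ R (head h₄)) ℕ.+ ((r₁ ℕ.+ R (tail h₁)) ℕ.+ (r₃ ℕ.+ R (head h₃)))
        ≡⟨ regroup′ r₁ r₂ r₃ r₄ (R (tail h₂)) (R (head h₄)) (R (tail h₁)) (R (head h₃)) ⟩
      (r₁ ℕ.+ r₂ ℕ.+ (r₃ ℕ.+ r₄)) ℕ.+ (R (head h₃) ℕ.+ R (head h₄) ℕ.+ (R (tail h₁) ℕ.+ R (tail h₂))) ∎)
      where
      regroup = solve 8 (λ a b c d s t u v →
        (a :+ b :+ (c :+ d)) :+ (s :+ t :+ (u :+ v)) := (a :+ s) :+ (b :+ t) :+ ((c :+ u) :+ (d :+ v))) refl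
      regroup′ = solve 8 (λ a b c d s t u v →
        (b :+ s) :+ (d :+ t) :+ ((a :+ u) :+ (c :+ v)) := (a :+ b :+ (c :+ d)) :+ (v :+ t :+ (u :+ s))) refl
    ring-y : R (head h₁) ℕ.+ R (tail h₃) ≡ R (head h₃) ℕ.+ R (tail h₁) → r₁ ℕ.+ R (head h₁) ≡ r₃ ℕ.+ R (head h₃)
    ring-y eq = ℕ.+-cancelʳ-≡ (R (tail h₁) ℕ.+ R (tail h₃)) _ _ (begin
      r₁ ℕ.+ R (head h₁) ℕ.+ (R (tail h₁) ℕ.+ R (tail h₃))
        ≡⟨ solve 4 (λ a b c d → a :+ b :+ (c :+ d) := (a :+ c) :+ (b :+ d)) refl r₁ (R (head h₁)) (R (tail h₁)) (R (tail h₃)) ⟩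
      r₁ ℕ.+ R (tail h₁) ℕ.+ (R (head h₁) ℕ.+ R (tail h₃))
        ≡⟨ cong₂ ℕ._+_ (cong proj₁ e₁₃) eq ⟩
      r₃ ℕ.+ R (tail h₃) ℕ.+ (R (head h₃) ℕ.+ R (tail h₁))
        ≡⟨ solve 4 (λ a b c d → (a :+ d) :+ (b :+ c) := a :+ b :+ (c :+ d)) refl r₃ (R (head h₃)) (R (tail h₁)) (R (tail h₃)) ⟩
      r₃ ℕ.+ R (head h₃) ℕ.+ (R (tail h₁) ℕ.+ R (tail h₃)) ∎)
    ring-x : R (head h₁) ℕ.+ R (head h₂) ≡ R (tail h₁) ℕ.+ R (tail h₂) → r₁ ℕ.+ R (tail h₁) ≡ r₂ ℕ.+ R (head h₂)
    ring-x eq = ℕ.+-cancelʳ-≡ (R (tail h₂)) _ _ (begin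
      r₁ ℕ.+ R (tail h₁) ℕ.+ R (tail h₂)      ≡⟨ ℕ.+-assoc r₁ _ _ ⟩
      r₁ ℕ.+ (R (tail h₁) ℕ.+ R (tail h₂))    ≡⟨ cong (r₁ ℕ.+_) eq ⟨
      r₁ ℕ.+ (R (head h₁) ℕ.+ R (head h₂))    ≡⟨ ℕ.+-assoc r₁ _ _ ⟨
      r₁ ℕ.+ R (head h₁) ℕ.+ R (head h₂)      ≡⟨ cong (ℕ._+ R (head h₂)) (cong proj₁ e₁₂) ⟩
      r₂ ℕ.+ R (tail h₂) ℕ.+ R (head h₂)      ≡⟨ solve 3 (λ a b c → a :+ b :+ c := a :+ c :+ b) refl r₂ (R (tail h₂)) (R (head h₂)) ⟩
      r₂ ℕ.+ R (head h₂) ℕ.+ R (tail h₂)      ∎)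

  -- The two walks from corner 0 to the opposite corner 2 would make corners 1 and 3, or corners 0
  -- and 2, coincide.
  square-free : CycleFree 4 (spiral n)
  square-free cycle = [ (λ eq → contradiction (distinct′ eq) λ ()) , (λ eq → contradiction (distinct′ eq) λ ()) ]′
    (common-neighbour (walk 0F 1F refl) (walk 1F 2F refl) (back 0F 3F refl) (back 3F 2F refl))
    where
    open Cycle cycle renaming (distinct to distinct′)
    walk : ∀ i j → toℕ j ≡ suc (toℕ i) ℕ.% 4 → Step (vert i) (vert j)
    walk i j next = step (vert i) (vert j) (closed i j next)
    back : ∀ i j → toℕ i ≡ suc (toℕ j) ℕ.% 4 → Step (vert i) (vert j)
    back i j next = step (vert i) (vert j) (symm (spiral n) (vert j) (vert i) (closed j i next))

  -- Drawing

  site : Fin n → ℚ²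
  site u = fromℤ² (pos (at u))

  site-injective : ∀ {u v} → fromℚ² (site u) ≈² fromℚ² (site v) → u ≡ v
  site-injective {u} {v} (nx , ny) = at-injective {u = u} {v = v} (pos-injective (at u) (at v)
    (cong₂ _,_ (coordinate nx) (coordinate ny)))
    where
    coordinate : ∀ {a b} → fromℚ (fromℤ a) ≈ fromℚ (fromℤ b) → a ≡ b
    -- `null-const` yields only a double negation, which decidable equality of rationals removes.
    coordinate {a} {b} null = fromℤ-injective (decidable-stable (fromℤ a ℚ.≟ fromℤ b)
      λ ≢ → null-const null (≢ ∘ -≡0⇒≡ (fromℤ a) (fromℤ b)))

  edge-≢ : (e : Edge (spiral n)) → lo e ≢ hi e
  edge-≢ e eq = ℕ.<-irrefl (cong toℕ eq) (link-< {u = lo e} {v = hi e} (edge-link e))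

  site-distinct : ∀ u v → u ≢ v → Distinct (site u) (site v)
  site-distinct u v u≢v = decide-x (proj₁ (pos (at u)) ℤ.≟ proj₁ (pos (at v)))
    where
    decide-x : Dec (proj₁ (pos (at u)) ≡ proj₁ (pos (at v))) → Distinct (site u) (site v)
    decide-x (no  x≢) = inj₁ λ eq → x≢ (sym (fromℤ-injective (-≡0⇒≡ (proj₁ (site v)) (proj₁ (site u)) eq)))
    decide-x (yes x≡) = inj₂ λ eq → u≢v (at-injective {u = u} {v = v} (pos-injective (at u) (at v)
      (cong₂ _,_ x≡ (sym (fromℤ-injective (-≡0⇒≡ (proj₂ (site v)) (proj₂ (site u)) eq))))))

  ends-distinct : (e : Edge (spiral n)) → Distinct (site (lo e)) (site (hi e))
  ends-distinct e = site-distinct (lo e) (hi e) (edge-≢ e)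

  line : (e : Edge (spiral n)) → Arc (fromℚ² (site (lo e))) (fromℚ² (site (hi e)))
  line e = segment (site (lo e)) (site (hi e)) (ends-distinct e)

  span : Edge (spiral n) → ℤ² × ℤ²
  span e = pos (at (lo e)) , pos (at (hi e))

  span-segAt : ∀ e {r t} → Joins r t (lo e) (hi e) → span e ≡ segAt r t
  span-segAt e (eq , eq′) = cong₂ _,_ (cong pos eq) (cong pos eq′)

  line-avoids : ∀ e w → ¬ InInterior (fromℚ² (site w)) (line e)
  line-avoids e w = avoid (edge-link e)
    where
    off′ : OffLine (span e) (pos (at w)) → orient (site (lo e)) (site (hi e)) (site w) ≢ 0ℚ
    off′ ≢ eq = ≢ (fromℤ-injective (trans (sym (orient-fromℤ² (pos (at (lo e))) (pos (at (hi e))) (pos (at w)))) eq))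

    avoid : Link (lo e) (hi e) → ¬ InInterior (fromℚ² (site w)) (line e)
    avoid (r , c , b , j@(eq , eq′)) =
      [ (λ w≡ → subst (λ u → ¬ InInterior (fromℚ² (site u)) (line e))
          (at-injective {u = lo e} {v = w} (trans eq (sym w≡))) (start-∉ (line e)))
      , [ (λ w≡ → subst (λ u → ¬ InInterior (fromℚ² (site u)) (line e))
            (at-injective {u = hi e} {v = w} (trans eq′ (sym w≡))) (end-∉ (line e)))
        , (λ off → off-line⇒∉ (site (lo e)) (site (hi e)) (site w) {ends-distinct e}
            (off′ (subst (λ f → OffLine f (pos (at w))) (sym (span-segAt e j)) off))) ]′ ]′
      (vertex-off (toℕ r) (ring (at w)) c b (class (at w)))

  drawing : Drawing (spiral n)
  drawing = record
    { place     = λ u → fromℚ² (site u)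
    ; place-inj = site-injective
    ; arc       = line
    ; avoids    = line-avoids
    }

  apart⇒disjoint : ∀ e f z → Apart (span e) (span f) → InInterior z (line e) → ¬ InInterior z (line f)
  apart⇒disjoint e f z (inj₁ clear) ze zf = one-side⇒disjoint (site (lo e)) (site (hi e)) (site (lo f)) (site (hi f)) {ends-distinct e} {ends-distinct f} {z}
    (clear⇒one-side (pos (at (lo e))) (pos (at (hi e))) (pos (at (lo f))) (pos (at (hi f))) clear) ze zf
  apart⇒disjoint e f z (inj₂ clear) ze zf = one-side⇒disjoint (site (lo f)) (site (hi f)) (site (lo e)) (site (hi e)) {ends-distinct f} {ends-distinct e} {z}
    (clear⇒one-side (pos (at (lo f))) (pos (at (hi f))) (pos (at (lo e))) (pos (at (hi e))) clear) zf ze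

  joins-≡ : ∀ {e f : Edge (spiral n)} {r t} → Joins r t (lo e) (hi e) → Joins r t (lo f) (hi f) → e ≡ f
  joins-≡ {e} {f} (le , he) (lf , hf) = edge-≡ (at-injective {u = lo e} {v = lo f} (trans le (sym lf)))
    (at-injective {u = hi e} {v = hi f} (trans he (sym hf)))

  -- Edges from different cells or rows are apart, so `f` shares the cell and the row of `e`; being
  -- another edge, it is the other entry.
  meet⇒partners : ∀ {e f z r c b} → Joins r (c , b) (lo e) (hi e) → f ≢ e →
    InInterior z (line e) → InInterior z (line f) →
    ∃ λ b′ → b ≢ b′ × Joins r (c , b′) (lo f) (hi f)
  meet⇒partners {e} {f} {z} {r} {c} {b} j f≢e ze zf = compare (edge-link f)
    where
    compare : Link (lo f) (hi f) → ∃ λ b′ → b ≢ b′ × Joins r (c , b′) (lo f) (hi f)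
    compare (r′ , c′ , b′ , j′) =
      [ (λ { (refl , refl) → b′ , (λ { refl → f≢e (joins-≡ {f} {e} j′ j) }) , j′ })
      , (λ apart → contradiction zf (apart⇒disjoint e f z
          (subst₂ Apart (sym (span-segAt e j)) (sym (span-segAt f j′)) apart) ze)) ]′
      (segments-apart r (toℕ r′) c b c′ b′)

  only-two : ∀ {b b′ b″ : Fin 2} → b ≢ b′ → b ≢ b″ → b′ ≡ b″
  only-two {0F} {0F}      b≢b′ _    = contradiction refl b≢b′
  only-two {0F} {1F} {0F} _    b≢b″ = contradiction refl b≢b″
  only-two {0F} {1F} {1F} _    _    = refl
  only-two {1F} {0F} {0F} _    _    = refl
  only-two {1F} {0F} {1F} _    b≢b″ = contradiction refl b≢b″
  only-two {1F} {1F}      b≢b′ _    = contradiction refl b≢b′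

  -- A row has only two entries, which fixes the other edge, and the two lines are not parallel,
  -- which fixes the point.
  same-crossing : ∀ e (x y : Crossing drawing e) → SameCrossing x y
  same-crossing e x y = compare (edge-link e)
    where
    f = other x
    Partner : ℕ → Fin 12 → Fin 2 → Edge (spiral n) → Set
    Partner r c b f = ∃ λ b′ → b ≢ b′ × Joins r (c , b′) (lo f) (hi f)
    unique : ∀ {r c b} → Joins r (c , b) (lo e) (hi e) → Partner r c b (other x) → Partner r c b (other y) → SameCrossing x y
    unique {r} {c} {b} j (b′ , b≢b′ , j′) (b″ , b≢b″ , j″) =
      f≡g , meet-unique (site (lo e)) (site (hi e)) (site (lo f)) (site (hi f))
        {ends-distinct e} {ends-distinct f} {point x} {point y} transversal (on-this x) (on-other x) (on-this y)
        (subst (λ h → InInterior (point y) (line h)) (sym f≡g) (on-other y))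
      where
      f≡g : other x ≡ other y
      f≡g = joins-≡ {other x} {other y} j′
        (subst (λ b → Joins r (c , b) (lo (other y)) (hi (other y))) (only-two b≢b″ b≢b′) j″)
      transversal : orient (site (lo f)) (site (hi f)) (site (lo e)) ≢ orient (site (lo f)) (site (hi f)) (site (hi e))
      transversal eq = subst₂ Transversal (sym (span-segAt e j)) (sym (span-segAt f j′)) (partners-transversal r c b b′ b≢b′)
        (fromℤ-injective (trans (sym (orient-fromℤ² (pos (at (lo f))) (pos (at (hi f))) (pos (at (lo e)))))
          (trans eq (orient-fromℤ² (pos (at (lo f))) (pos (at (hi f))) (pos (at (hi e)))))))
    compare : Link (lo e) (hi e) → SameCrossing x y
    compare (r , c , b , j) = unique j
      (meet⇒partners {e} {other x} {point x} j (other≢ x) (on-this x) (on-other x))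
      (meet⇒partners {e} {other y} {point y} j (other≢ y) (on-this y) (on-other y))

  one-planar : (1 -planar) (spiral n)
  one-planar = drawing , λ e (c , inj) → contradiction (inj {0F} {1F} (same-crossing e (c 0F) (c 1F))) λ ()

-- Counting edges

edge-∈ : ∀ {n} (G : Graph n) {u v} → toℕ u ℕ.< toℕ v → T (adj G u v) → (u , v) ∈ edgePairs G
edge-∈ G {u} {v} u<v uv = ∈-filter⁺ _ (∈-cartesianProduct⁺ (∈-allFin u) (∈-allFin v)) (u<v , uv)

link⇒∈ : ∀ {n} (u v : Fin n) → Link u v → (u , v) ∈ edgePairs (spiral n)
link⇒∈ {n} u v l = edge-∈ (spiral n) (link-< {u = u} {v = v} l) (fromWitness {a? = adjacent? u v} (inj₁ l))

-- Edges of the first `R` cells reach into the period after the last of these cells, so room for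
-- `suc R` full periods is required.
module _ {n R : ℕ} (fits : suc R ℕ.* 10 ℕ.≤ n) where

  number-bound : ∀ {r} → r ℕ.< R → ∀ v → ring v ℕ.< 2 → number (shift r v) ℕ.< n
  number-bound {r} r<R (o , i) (ℕ.s≤s o≤1) = ℕ.<-≤-trans (begin-strict
    toℕ i ℕ.+ (r ℕ.+ o) ℕ.* 10  <⟨ ℕ.+-monoˡ-< ((r ℕ.+ o) ℕ.* 10) (Fin.toℕ<n i) ⟩
    suc (r ℕ.+ o) ℕ.* 10        ≤⟨ ℕ.*-monoˡ-≤ 10 (ℕ.s≤s (ℕ.+-monoʳ-≤ r o≤1)) ⟩
    suc (r ℕ.+ 1) ℕ.* 10        ≡⟨ cong (λ k → suc k ℕ.* 10) (ℕ.+-comm r 1) ⟩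
    suc (suc r) ℕ.* 10          ≤⟨ ℕ.*-monoˡ-≤ 10 (ℕ.s≤s r<R) ⟩
    suc R ℕ.* 10                ∎) fits
    where open ℕ.≤-Reasoning

  node : (r : Fin R) (v : Vertex) → ring v ℕ.< 2 → Fin n
  node r v v<2 = Fin.fromℕ< (number-bound (Fin.toℕ<n r) v v<2)

  at-node : ∀ r v v<2 → at (node r v v<2) ≡ shift (toℕ r) v
  at-node r v v<2 = trans (cong vertex (Fin.toℕ-fromℕ< (number-bound (Fin.toℕ<n r) v v<2)))
    (vertex-number (shift (toℕ r) v))

  pair : Fin R → Fin 12 → Fin 2 → Fin n × Fin n
  pair r c b = node r (proj₁ (endpoints (c , b))) (proj₁ (offset c b))
             , node r (proj₂ (endpoints (c , b))) (proj₂ (offset c b))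

  pair-joins : ∀ r c b → uncurry (Joins (toℕ r) (c , b)) (pair r c b)
  pair-joins r c b = at-node r _ (proj₁ (offset c b)) , at-node r _ (proj₂ (offset c b))

  R≤n : R ℕ.≤ n
  R≤n = ℕ.≤-trans (ℕ.n≤1+n R) (ℕ.≤-trans (ℕ.m≤m*n (suc R) 10) fits)

  pair-∈ : ∀ r c b → pair r c b ∈ edgePairs (spiral n)
  pair-∈ r c b = link⇒∈ (proj₁ (pair r c b)) (proj₂ (pair r c b)) (Fin.inject≤ r R≤n , c , b ,
    subst (λ k → uncurry (Joins k (c , b)) (pair r c b)) (sym (Fin.toℕ-inject≤ r R≤n)) (pair-joins r c b))

  pair-injective : ∀ r c b r′ c′ b′ → pair r c b ≡ pair r′ c′ b′ → (r , c , b) ≡ (r′ , c′ , b′)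
  pair-injective r c b r′ c′ b′ eq = conclude (classes-unique c b c′ b′ (cong proj₂ lo≡) (cong proj₂ hi≡))
    where
    lo≡ : shift (toℕ r) (proj₁ (endpoints (c , b))) ≡ shift (toℕ r′) (proj₁ (endpoints (c′ , b′)))
    lo≡ = trans (sym (proj₁ (pair-joins r c b))) (trans (cong (at ∘ proj₁) eq) (proj₁ (pair-joins r′ c′ b′)))
    hi≡ : shift (toℕ r) (proj₂ (endpoints (c , b))) ≡ shift (toℕ r′) (proj₂ (endpoints (c′ , b′)))
    hi≡ = trans (sym (proj₂ (pair-joins r c b))) (trans (cong (at ∘ proj₂) eq) (proj₂ (pair-joins r′ c′ b′)))
    conclude : c ≡ c′ × b ≡ b′ → (r , c , b) ≡ (r′ , c′ , b′)
    conclude (refl , refl) = cong (_, c , b) (Fin.toℕ-injective (ℕ.+-cancelʳ-≡ _ (toℕ r) (toℕ r′) (cong proj₁ lo≡)))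

  decode : Fin (R ℕ.* 24) → Fin R × Fin 12 × Fin 2
  decode k = proj₁ (Fin.remQuot {R} 24 k) , Fin.remQuot {12} 2 (proj₂ (Fin.remQuot {R} 24 k))

  decode-injective : ∀ {k l} → decode k ≡ decode l → k ≡ l
  decode-injective {k} {l} eq = trans (sym (encode-decode k)) (trans (cong encode eq) (encode-decode l))
    where
    encode : Fin R × Fin 12 × Fin 2 → Fin (R ℕ.* 24)
    encode (r , c , b) = Fin.combine r (Fin.combine c b)
    encode-decode : ∀ k → encode (decode k) ≡ k
    encode-decode k = trans (cong (Fin.combine (proj₁ (Fin.remQuot {R} 24 k)))
      (Fin.combine-remQuot {12} 2 (proj₂ (Fin.remQuot {R} 24 k)))) (Fin.combine-remQuot {R} 24 k)

  -- Sending each edge to its place in the list is injective, since one place holds one pair.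
  edgeCount-≥ : R ℕ.* 24 ℕ.≤ edgeCount (spiral n)
  edgeCount-≥ = Fin.injective⇒≤ {f = position} λ {k} {l} eq → decode-injective
    (pair-injective _ _ _ _ _ _ (Membershipₛ.index-injective (setoid (Fin n × Fin n)) (member k) (member l) eq))
    where
    member : ∀ k → (let (r , c , b) = decode k in pair r c b) ∈ edgePairs (spiral n)
    member k = let (r , c , b) = decode k in pair-∈ r c b
    position : Fin (R ℕ.* 24) → Fin (edgeCount (spiral n))
    position k = index (member k)

-- Fewer than 20 vertices lie beyond the first `R` periods: the last full period and the remainder
-- modulo 10. At 2.4 edges per vertex they cost at most 48 edges.
edgeCount-linear : ∀ n → 10 ℕ.≤ n → 24 ℕ.* n ℕ.≤ 10 ℕ.* (edgeCount (spiral n) ℕ.+ 48)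
edgeCount-linear n 10≤n = begin
  24 ℕ.* n                                    ≡⟨ cong (24 ℕ.*_) (m≡m%n+[m/n]*n n 10) ⟩
  24 ℕ.* (n ℕ.% 10 ℕ.+ n ℕ./ 10 ℕ.* 10)       ≡⟨ cong (λ q → 24 ℕ.* (n ℕ.% 10 ℕ.+ q ℕ.* 10)) (sym q≡) ⟩
  24 ℕ.* (n ℕ.% 10 ℕ.+ suc R ℕ.* 10)          ≤⟨ ℕ.*-monoʳ-≤ 24 (ℕ.+-monoˡ-≤ (suc R ℕ.* 10) (ℕ.<⇒≤ (m%n<n n 10))) ⟩
  24 ℕ.* (10 ℕ.+ suc R ℕ.* 10)                ≡⟨ solve 1 (λ R → con 24 :* (con 10 :+ (con 1 :+ R) :* con 10) := con 10 :* (R :* con 24 :+ con 48)) refl R ⟩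
  10 ℕ.* (R ℕ.* 24 ℕ.+ 48)                    ≤⟨ ℕ.*-monoʳ-≤ 10 (ℕ.+-monoˡ-≤ 48 (edgeCount-≥ {R = R} fits)) ⟩
  10 ℕ.* (edgeCount (spiral n) ℕ.+ 48)        ∎
  where
  open ℕ.≤-Reasoning
  open ℕ-Solver
  -- The quotient is positive by `10 ≤ n`, so this is a true predecessor.
  R = ℕ.pred (n ℕ./ 10)
  q≡ : suc R ≡ n ℕ./ 10
  q≡ = ℕ.suc-pred (n ℕ./ 10) {{ℕ.>-nonZero (m≥n⇒m/n>0 10≤n)}}
  fits : suc R ℕ.* 10 ℕ.≤ n
  fits = subst (λ q → q ℕ.* 10 ℕ.≤ n) (sym q≡) (m/n*n≤m n 10)

-- The density bound in rational numbers.

ℕ→ℚ≡fromℤ : ∀ n → ℕ→ℚ n ≡ fromℤ (+ n)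
ℕ→ℚ≡fromℤ n = ℚ.↥p/↧p≡p (fromℤ (+ n))

-- Ten times the difference of the two sides is the image of an integer, whose sign the hypothesis
-- supplies.
density : ∀ n m → 24 ℕ.* n ℕ.≤ 10 ℕ.* (m ℕ.+ 48) →
  (+ 24 ℚ./ 10) ℚ.* ℕ→ℚ n ℚ.- ℕ→ℚ 48 ℚ.≤ ℕ→ℚ m
density n m le = subst₂ (λ x y → (+ 24 ℚ./ 10) ℚ.* x ℚ.- ℕ→ℚ 48 ℚ.≤ y) (sym (ℕ→ℚ≡fromℤ n)) (sym (ℕ→ℚ≡fromℤ m))
  (ℚ.*-cancelˡ-≤-pos (fromℤ (+ 10)) (0≤-⇒≤ (subst (0ℚ ℚ.≤_) identity (≤⇒0≤- (fromℤ-mono-≤ (ℤ.+≤+ le))))))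
  where
  open ℚ-Solver
  identity : fromℤ (+ (10 ℕ.* (m ℕ.+ 48))) ℚ.- fromℤ (+ (24 ℕ.* n)) ≡
    fromℤ (+ 10) ℚ.* fromℤ (+ m) ℚ.- fromℤ (+ 10) ℚ.* ((+ 24 ℚ./ 10) ℚ.* fromℤ (+ n) ℚ.- ℕ→ℚ 48)
  identity = trans (cong₂ ℚ._-_
      (trans (cong fromℤ (ℤ.pos-* 10 (m ℕ.+ 48))) (trans (fromℤ-* (+ 10) (+ (m ℕ.+ 48)))
        (cong (fromℤ (+ 10) ℚ.*_) (fromℤ-+ (+ m) (+ 48)))))
      (trans (cong fromℤ (ℤ.pos-* 24 n)) (fromℤ-* (+ 24) (+ n))))
    (solve 2 (λ x y → con (fromℤ (+ 10)) :* (y :+ con (fromℤ (+ 48))) :- con (fromℤ (+ 24)) :* x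
      := con (fromℤ (+ 10)) :* y :- con (fromℤ (+ 10)) :* (con (+ 24 ℚ./ 10) :* x :- con (ℕ→ℚ 48))) refl
      (fromℤ (+ n)) (fromℤ (+ m)))

theorem7 : ∃ λ (C : ℚ) → ∃ λ (N : ℕ) → (n : ℕ) → N ≤ℕ n →
    ∃ λ (G : Graph n) →
    CycleFree 4 G × (1 -planar) G ×
    ((+ 24 / 10) * ℕ→ℚ n - C ≤ℚ ℕ→ℚ (edgeCount G))
theorem7 = ℕ→ℚ 48 , 10 , λ n 10≤n → spiral n , square-free , one-planar ,
  density n (edgeCount (spiral n)) (edgeCount-linear n 10≤n)
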